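{- Let $r$ and $s$ be any non-zero integers that are prime to each other and to $3$. Then the polynomial $p(x,3r/s)=x^3-3x-\frac{3r}{s}$ is irreducible over $\mathbb{Q}$. Hence no such $3r/s$ in $[-2,2]$ belongs to $Tri$.
   Context: Let $S\subseteq\mathbb{R}^2$ contain $(0,0)$ and $(1,0)$. A point is constructible over $S$ if it can be obtained from points of $S$ by a finite sequence of straightedge-and-compass steps: (1) given two distinct points already available, one may draw the line through them, or the circle centered at one of them and passing through the other; (2) given two lines, two circles, or a line and a circle already drawn, one may add their intersection points. $C(S)$ denotes the set of all points constructible over $S$. An angle $\alpha$ (in radians) is trisectable if $(\cos(\alpha/3),\sin(\alpha/3))\in C(\{(0,0),(1,0),(\cos\alpha,\sin\alpha)\})$. A trisection number is a real number of the form $2\cos\alpha$ with $\alpha$ trisectable; $Tri\subseteq[-2,2]$ is the set of all trisection numbers. -}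

module Defs where

open import Level using (Level; _⊔_; 0ℓ) renaming (suc to lsuc)
open import Algebra.Apartness.Bundles using (HeytingCommutativeRing; HeytingField)
open import Algebra.Bundles using (CommutativeRing; RawSemiring; Semiring)
import Algebra.Definitions.RawSemiring as SemiringDefs
open import Data.Fin.Base using (toℕ)
open import Data.Integer.Base as ℤ using (ℤ; +_; -[1+_])
open import Data.List.Base using (List; []; _∷_; map)
open import Data.Nat.Base as ℕ using (ℕ; zero; suc; _!)
open import Data.Nat.Coprimality as Coprimality using (1-coprimeTo)
open import Data.Nat.Properties using (_!≢0)
open import Data.Product.Base using (∃-syntax; _×_; _,_; proj₁)
open import Data.Rational.Base as ℚ using (ℚ; mkℚ; 0ℚ; 1ℚ)
open import Data.Sum.Base using (_⊎_; inj₂)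
open import Function.Bundles using (_⇔_; module Equivalence)
open import Relation.Binary.Core using (Rel)
open import Relation.Binary.PropositionalEquality.Core using (_≡_)
open import Relation.Binary.Structures using (IsStrictPartialOrder)
open import Relation.Nullary.Negation using (¬_)
open import Relation.Unary using (Pred)

------------------------------------------------------------------------
-- Polynomials over ℚ: coefficient lists, constant term first, trailing
-- zeros allowed and ignored by the equality.

Poly : Set
Poly = List ℚ

coeff : Poly → ℕ → ℚ
coeff []      _       = 0ℚ
coeff (a ∷ f) zero    = a
coeff (a ∷ f) (suc i) = coeff f i

infix  4 _≈ᵖ_
infixl 6 _+ᵖ_
infixl 7 _*ᵖ_

_≈ᵖ_ : Rel Poly 0ℓ
f ≈ᵖ g = ∀ i → coeff f i ≡ coeff g i

_+ᵖ_ : Poly → Poly → Poly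
[]      +ᵖ g       = g
(a ∷ f) +ᵖ []      = a ∷ f
(a ∷ f) +ᵖ (b ∷ g) = a ℚ.+ b ∷ f +ᵖ g

_*ᵖ_ : Poly → Poly → Poly
[]      *ᵖ g = []
(a ∷ f) *ᵖ g = map (a ℚ.*_) g +ᵖ (0ℚ ∷ f *ᵖ g)

ℚ[X] : RawSemiring 0ℓ 0ℓ
ℚ[X] = record
  { Carrier = Poly
  ; _≈_     = _≈ᵖ_
  ; _+_     = _+ᵖ_
  ; _*_     = _*ᵖ_
  ; 0#      = []
  ; 1#      = 1ℚ ∷ []
  }

open SemiringDefs ℚ[X] public using (Irreducible)

-- x³ - 3x - a
p[x,_] : ℚ → Poly
p[x, a ] = ℚ.- a ∷ ℚ.- (+ 3 ℚ./ 1) ∷ 0ℚ ∷ 1ℚ ∷ []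

-- Unlike i / 1, this has numerator i by computation, so that a NonZero
-- instance for i is also one for ℤ⇒ℚ i.
ℤ⇒ℚ : ℤ → ℚ
ℤ⇒ℚ i = mkℚ i 0 (Coprimality.sym (1-coprimeTo ℤ.∣ i ∣))

infixl 7 _÷ℤ_
_÷ℤ_ : (i j : ℤ) → .{{ℤ.NonZero j}} → ℚ
i ÷ℤ j = ℤ⇒ℚ i ℚ.÷ ℤ⇒ℚ j

------------------------------------------------------------------------
-- The real numbers, as an Archimedean, Cauchy complete ordered field.
-- The order is only required to be constructively reasonable (no
-- trichotomy), so that the Cauchy reals are a model without excluded
-- middle; classically ℝ is the only model up to isomorphism.

record RealNumbers c ℓ₁ ℓ₂ : Set (lsuc (c ⊔ ℓ₁ ⊔ ℓ₂)) where
  infix 4 _<_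
  field
    heytingField : HeytingField c ℓ₁ ℓ₂

  open HeytingField heytingField public
  open HeytingCommutativeRing heytingCommutativeRing public using (commutativeRing)
  open CommutativeRing commutativeRing public using (semiring)
  open Semiring semiring public using (rawSemiring)
  open SemiringDefs rawSemiring public using (_^_; sum) renaming (_×_ to _·_)

  field
    _<_                  : Rel Carrier ℓ₂
    isStrictPartialOrder : IsStrictPartialOrder _≈_ _<_
    #⇔<⊎>                : ∀ {x y} → x # y ⇔ (x < y ⊎ y < x)
    0<1                  : 0# < 1#
    +-monoʳ-<            : ∀ x {y z} → y < z → x + y < x + z
    *-pos                : ∀ {x y} → 0# < x → 0# < y → 0# < x * y
    archimedean          : ∀ x → ∃[ n ] x < n · 1#

  Within : Carrier → Rel Carrier ℓ₂
  Within ε x y = - ε < x - y × x - y < ε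

  infix 4 _⟶_
  _⟶_ : (ℕ → Carrier) → Carrier → Set (c ⊔ ℓ₂)
  u ⟶ l = ∀ ε → 0# < ε → ∃[ N ] ∀ n → N ℕ.≤ n → Within ε (u n) l

  Cauchy : (ℕ → Carrier) → Set (c ⊔ ℓ₂)
  Cauchy u = ∀ ε → 0# < ε →
             ∃[ N ] ∀ m n → N ℕ.≤ m → N ℕ.≤ n → Within ε (u m) (u n)

  field
    complete : ∀ u → Cauchy u → ∃[ l ] u ⟶ l

module _ {c ℓ₁ ℓ₂ : Level} (ℝ : RealNumbers c ℓ₁ ℓ₂) where
  open RealNumbers ℝ
  private module < = IsStrictPartialOrder isStrictPartialOrder

  0<1+n : ∀ n → 0# < suc n · 1#
  0<1+n zero    = <.<-respʳ-≈ (sym (+-identityʳ 1#)) 0<1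
  0<1+n (suc n) = <.trans 0<1
    (<.<-respˡ-≈ (+-identityʳ 1#) (+-monoʳ-< 1# (0<1+n n)))

  ℤ⇒ℝ : ℤ → Carrier
  ℤ⇒ℝ (+ n)    = n · 1#
  ℤ⇒ℝ -[1+ n ] = - (suc n · 1#)

  -- The inverse supplied here is, literally, that of (1 + n) · 1# - 0#.
  1/1+ : ℕ → Carrier
  1/1+ n = proj₁ (#⇒invertible (Equivalence.from #⇔<⊎> (inj₂ (0<1+n n))))

  ℚ⇒ℝ : ℚ → Carrier
  ℚ⇒ℝ q = ℤ⇒ℝ (ℚ.↥ q) * 1/1+ (ℚ.denominator-1 q)

  ----------------------------------------------------------------------
  -- Straightedge-and-compass constructions

  Point : Set c
  Point = Carrier × Carrier

  infix 4 _≈ₚ_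
  _≈ₚ_ : Rel Point ℓ₁
  (x , y) ≈ₚ (x′ , y′) = x ≈ x′ × y ≈ y′

  dist² : Point → Point → Carrier
  dist² (x , y) (x′ , y′) = (x - x′) ^ 2 + (y - y′) ^ 2

  data Curve : Set c where
    line   : (A B : Point) → Curve
    circle : (centre through : Point) → Curve

  infix 4 _on_
  _on_ : Point → Curve → Set ℓ₁
  (x , y) on line (a , b) (a′ , b′) =
    (x - a) * (b′ - b) ≈ (y - b) * (a′ - a)
  P on circle O A = dist² P O ≈ dist² A O

  SameCurve : Rel Curve (c ⊔ ℓ₁)
  SameCurve K L = ∀ P → (P on K) ⇔ (P on L)

  mutual
    data Constructible {ℓ} (S : Pred Point ℓ) : Pred Point (c ⊔ ℓ₁ ⊔ ℓ) where
      given     : ∀ {P} → S P → Constructible S P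
      intersect : ∀ {P K L} → Drawable S K → Drawable S L →
                  ¬ SameCurve K L → P on K → P on L → Constructible S P

    data Drawable {ℓ} (S : Pred Point ℓ) : Pred Curve (c ⊔ ℓ₁ ⊔ ℓ) where
      draw-line   : ∀ {A B} → Constructible S A → Constructible S B →
                    ¬ (A ≈ₚ B) → Drawable S (line A B)
      draw-circle : ∀ {A B} → Constructible S A → Constructible S B →
                    ¬ (A ≈ₚ B) → Drawable S (circle A B)

  ----------------------------------------------------------------------
  -- Cosine and sine, as the sums of their power series

  infix 4 _HasSum_
  _HasSum_ : (ℕ → Carrier) → Carrier → Set (c ⊔ ℓ₂)
  t HasSum l = (λ n → sum {n} (λ k → t (toℕ k))) ⟶ l

  1/_! : ℕ → Carrier
  1/ n ! = ℚ⇒ℝ ((+ 1 ℚ./ (n !)) {{n !≢0}})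

  cosTerm sinTerm : Carrier → ℕ → Carrier
  cosTerm α k = (- 1#) ^ k * (α ^ (2 ℕ.* k) * 1/ (2 ℕ.* k) !)
  sinTerm α k = (- 1#) ^ k * (α ^ (1 ℕ.+ 2 ℕ.* k) * 1/ (1 ℕ.+ 2 ℕ.* k) !)

  -- The point is (cos α , sin α).  Limits being unique, it is determined
  -- up to _≈ₚ_, and it exists by completeness.
  IsCosSin : Carrier → Point → Set (c ⊔ ℓ₂)
  IsCosSin α (x , y) = (cosTerm α HasSum x) × (sinTerm α HasSum y)

  ----------------------------------------------------------------------
  -- Trisection

  Trisectable : Carrier → Set (c ⊔ ℓ₁ ⊔ ℓ₂)
  Trisectable α =
    ∃[ P ] ∃[ Q ] IsCosSin α P × IsCosSin (ℚ⇒ℝ (+ 1 ℚ./ 3) * α) Q ×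
      Constructible (λ X → X ≈ₚ (0# , 0#) ⊎ X ≈ₚ (1# , 0#) ⊎ X ≈ₚ P) Q

  Tri : Pred Carrier (c ⊔ ℓ₁ ⊔ ℓ₂)
  Tri x = ∃[ α ] ∃[ P ] Trisectable α × IsCosSin α P × x ≈ 2 · proj₁ P

{-# OPTIONS --safe #-}
module Submission where

-- If i / n is a root of x³ - 3x - 3r/s then s i³ = 3 n² (s i + r n), so 3
-- divides i and then n.  By infinite descent there is no rational root,
-- and a cubic polynomial without a rational root is irreducible.
--
-- If 3r/s = 2 cos α then, by the triple angle formula, 2 cos (α / 3) is a
-- root in ℝ.  That formula and cos² + sin² = 1 come from the addition
-- theorem, i.e. from the Cauchy product of the exponential series.  Since
-- sin² α = 1 - cos² α is rational, a point constructible from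
-- (cos α , sin α) has its coordinates in a tower of quadratic extensions
-- of ℚ.  Such a tower contains no root: if u + vw with v ≠ 0 is a root in
-- F(w), where w² ∈ F, then so is u - vw, and the third root -2u is in F.
--
-- The goal being negative, one may distinguish cases on _<_, _≈_ and
-- membership in a subfield under a double negation.  Hence x ≤ y stands for
-- ¬ (y < x), subfields are ¬¬-stable predicates, and towers are only shown
-- not to be absent.

open import Defs
open import Level using (Level; _⊔_; Lift; lift; lower) renaming (suc to lsuc)
import Algebra.Definitions.RawSemiring as SemiringDefs
import Algebra.Properties.AbelianGroup as AbelianGroupProperties
import Algebra.Properties.CommutativeSemigroup as CommutativeSemigroupProperties
import Algebra.Properties.Ring as RingProperties
import Algebra.Properties.Semiring.Mult as Mult
import Algebra.Properties.Semiring.Mult.TCOptimised as Mult′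
import Algebra.Solver.Ring
open import Algebra.Bundles using (CommutativeRing)
open import Algebra.Definitions.RawMagma using (_,_)
open import Algebra.Solver.Ring.AlmostCommutativeRing using (fromCommutativeRing; _-Raw-AlmostCommutative⟶_)
open import Data.Empty using (⊥; ⊥-elim)
open import Data.Fin.Base using (toℕ)
open import Data.Integer.Base as ℤ using (ℤ; +_; -[1+_]; +0; +[1+_]; 0ℤ)
open import Data.Integer.Coprimality using (Coprime)
import Data.Integer.Divisibility.Signed as ℤ
import Data.Integer.GCD as ℤ
import Data.Integer.Properties as ℤ
open import Data.Integer.Tactic.RingSolver using (solve-∀)
open import Data.List.Base using ([]; _∷_; map)
open import Data.Maybe.Base using (Maybe; just; nothing)
open import Data.Nat.Base as ℕ using (ℕ; zero; suc; z≤n; s≤s; _!)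
import Data.Nat.Divisibility as ℕ
open import Data.Nat.Primality using (prime?; euclidsLemma)
import Data.Nat.Properties as ℕ
open import Data.Product.Base using (∃-syntax; _×_; _,_; proj₁; proj₂)
open import Data.Rational.Base as ℚ using (ℚ; 0ℚ; 1ℚ; toℚᵘ)
import Data.Rational.Properties as ℚ
open import Data.Rational.Solver using (module +-*-Solver)
import Data.Rational.Unnormalised.Base as ℚᵘ
import Data.Rational.Unnormalised.Properties as ℚᵘ
open import Data.Sum.Base using (_⊎_; inj₁; inj₂; [_,_]′)
open import Function.Bundles using (_⇔_; mk⇔; module Equivalence)
open import Relation.Binary.PropositionalEquality as ≡ using (_≡_)
open import Relation.Binary.Structures using (IsStrictPartialOrder)
open import Relation.Nullary.Decidable using (yes; no; from-yes)
open import Relation.Nullary.Negation using (¬_)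
open import Relation.Unary using (Pred)

-- The addition theorem has to come from the bare power series. Binomial coefficients are avoided:
-- the terms of both series are characterised by the recurrences that express cos′ = - sin and sin′
-- = cos coefficient by coefficient, convolution obeys the Leibniz rule, and the recurrences have
-- only one solution. Convergence of the convolved series rests on domination by exponential series
-- with a natural number as argument, whose terms at least halve from an explicit index on.
--
-- What is preserved along a tower is the absence of a root rather than a statement about degrees,
-- so no linear algebra enters. Nor are square roots extracted: an intersection point is given, and
-- it suffices to name a combination of its coordinates that is quadratic over the field.

module _ where
  open ≡

  -- The root equation over ℤ and ℚ

  3ℤ : ℤ
  3ℤ = + 3

  coprime-3 : ∀ i → Coprime i 3ℤ → ¬ (3ℤ ℤ.∣ i)
  coprime-3 i coprime 3∣i with coprime (ℤ.∣⇒∣ᵤ 3∣i , ℕ.∣-refl)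
  ... | ()

  3∣*⇒3∣⊎3∣ : ∀ i j → 3ℤ ℤ.∣ i ℤ.* j → 3ℤ ℤ.∣ i ⊎ 3ℤ ℤ.∣ j
  3∣*⇒3∣⊎3∣ i j 3∣ij =
    [ (λ d → inj₁ (ℤ.∣ᵤ⇒∣ d)) , (λ d → inj₂ (ℤ.∣ᵤ⇒∣ d)) ]′
      (euclidsLemma ℤ.∣ i ∣ ℤ.∣ j ∣ (from-yes (prime? 3)) (subst (3 ℕ.∣_) (ℤ.abs-* i j) (ℤ.∣⇒∣ᵤ 3∣ij)))

  3∣*cube : ∀ i j → ¬ (3ℤ ℤ.∣ i) → 3ℤ ℤ.∣ i ℤ.* (j ℤ.* j ℤ.* j) → 3ℤ ℤ.∣ j
  3∣*cube i j 3∤i 3∣ with 3∣*⇒3∣⊎3∣ i (j ℤ.* j ℤ.* j) 3∣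
  ... | inj₁ 3∣i = ⊥-elim (3∤i 3∣i)
  ... | inj₂ 3∣jjj with 3∣*⇒3∣⊎3∣ (j ℤ.* j) j 3∣jjj
  ...   | inj₂ 3∣j = 3∣j
  ...   | inj₁ 3∣jj = [ (λ d → d) , (λ d → d) ]′ (3∣*⇒3∣⊎3∣ j j 3∣jj)

  -- s i³ = 3 s i n² + 3 r n³, i.e. i / n is a root of x³ - 3x - 3r/s.
  RootEquation : (r s i n : ℤ) → Set
  RootEquation r s i n =
    s ℤ.* (i ℤ.* i ℤ.* i) ≡ (t ℤ.+ (t ℤ.+ t)) ℤ.+ (3ℤ ℤ.* r) ℤ.* (n ℤ.* n ℤ.* n)
    where t = s ℤ.* i ℤ.* (n ℤ.* n)

  module _ (r s : ℤ) (3∤r : ¬ (3ℤ ℤ.∣ r)) (3∤s : ¬ (3ℤ ℤ.∣ s)) where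
    3∣numerator : ∀ i n → RootEquation r s i n → 3ℤ ℤ.∣ i
    3∣numerator i n eq = 3∣*cube s i 3∤s
      (ℤ.divides (s ℤ.* i ℤ.* (n ℤ.* n) ℤ.+ r ℤ.* (n ℤ.* n ℤ.* n)) (trans eq (lemma r s i n)))
      where
      lemma : ∀ r s i n → s ℤ.* i ℤ.* (n ℤ.* n) ℤ.+
          (s ℤ.* i ℤ.* (n ℤ.* n) ℤ.+ s ℤ.* i ℤ.* (n ℤ.* n)) ℤ.+ (+ 3 ℤ.* r) ℤ.* (n ℤ.* n ℤ.* n)
        ≡ (s ℤ.* i ℤ.* (n ℤ.* n) ℤ.+ r ℤ.* (n ℤ.* n ℤ.* n)) ℤ.* + 3
      lemma = solve-∀

    -- With i = 3j the equation reads 27 s j³ = 9 s j n² + 3 r n³, hence r n³ = 3 (3 s j³ - s j n²),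
    -- and 3 does not divide r.
    3∣denominator : ∀ j n → RootEquation r s (j ℤ.* 3ℤ) n → 3ℤ ℤ.∣ n
    3∣denominator j n eq = 3∣*cube r n 3∤r
      (ℤ.divides (s ℤ.* (j ℤ.* j ℤ.* j) ℤ.* + 3 ℤ.- s ℤ.* j ℤ.* (n ℤ.* n))
        (ℤ.*-cancelˡ-≡ (+ 3) _ _ (trans (lemma₁ r s j n)
          (trans (cong (ℤ._- + 9 ℤ.* (s ℤ.* j ℤ.* (n ℤ.* n))) (sym eq)) (lemma₂ s j n)))))
      where
      lemma₁ : ∀ r s j n → + 3 ℤ.* (r ℤ.* (n ℤ.* n ℤ.* n)) ≡
        (s ℤ.* (j ℤ.* + 3) ℤ.* (n ℤ.* n) ℤ.+
            (s ℤ.* (j ℤ.* + 3) ℤ.* (n ℤ.* n) ℤ.+ s ℤ.* (j ℤ.* + 3) ℤ.* (n ℤ.* n)) ℤ.+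
            (+ 3 ℤ.* r) ℤ.* (n ℤ.* n ℤ.* n))
          ℤ.- + 9 ℤ.* (s ℤ.* j ℤ.* (n ℤ.* n))
      lemma₁ = solve-∀
      lemma₂ : ∀ s j n → s ℤ.* ((j ℤ.* + 3) ℤ.* (j ℤ.* + 3) ℤ.* (j ℤ.* + 3)) ℤ.- + 9 ℤ.*
          (s ℤ.* j ℤ.* (n ℤ.* n)) ≡
        + 3 ℤ.* ((s ℤ.* (j ℤ.* j ℤ.* j) ℤ.* + 3 ℤ.- s ℤ.* j ℤ.* (n ℤ.* n)) ℤ.* + 3)
      lemma₂ = solve-∀

    -- The equation is homogeneous of degree 3 in (i , n), so a common factor 3 contributes 27 to
    -- both sides.
    rootEquation-÷3 : ∀ j m → RootEquation r s (j ℤ.* 3ℤ) (m ℤ.* 3ℤ) → RootEquation r s j m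
    rootEquation-÷3 j m eq = ℤ.*-cancelˡ-≡ (+ 27) _ _ (trans (lemma₁ s j) (trans eq (lemma₂ r s j m)))
      where
      lemma₁ : ∀ s j → + 27 ℤ.* (s ℤ.* (j ℤ.* j ℤ.* j))
          ≡ s ℤ.* ((j ℤ.* + 3) ℤ.* (j ℤ.* + 3) ℤ.* (j ℤ.* + 3))
      lemma₁ = solve-∀
      lemma₂ : ∀ r s j m →
        s ℤ.* (j ℤ.* + 3) ℤ.* ((m ℤ.* + 3) ℤ.* (m ℤ.* + 3)) ℤ.+
            (s ℤ.* (j ℤ.* + 3) ℤ.* ((m ℤ.* + 3) ℤ.* (m ℤ.* + 3)) ℤ.+ s ℤ.* (j ℤ.* + 3) ℤ.*
            ((m ℤ.* + 3) ℤ.* (m ℤ.* + 3)))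
          ℤ.+ (+ 3 ℤ.* r) ℤ.* ((m ℤ.* + 3) ℤ.* (m ℤ.* + 3) ℤ.* (m ℤ.* + 3)) ≡
        + 27 ℤ.* (s ℤ.* j ℤ.* (m ℤ.* m) ℤ.+ (s ℤ.* j ℤ.* (m ℤ.* m) ℤ.+ s ℤ.* j ℤ.* (m ℤ.* m)) ℤ.+
            (+ 3 ℤ.* r) ℤ.* (m ℤ.* m ℤ.* m))
      lemma₂ = solve-∀

    descent : ∀ i n → RootEquation r s i n → ∃[ j ] ∃[ m ] n ≡ m ℤ.* 3ℤ × RootEquation r s j m
    descent i n eq =
      let ℤ.divides j i≡3j = 3∣numerator i n eq
          eq₁ = subst (λ i → RootEquation r s i n) i≡3j eq
          ℤ.divides m n≡3m = 3∣denominator j n eq₁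
      in j , m , n≡3m , rootEquation-÷3 j m (subst (RootEquation r s (j ℤ.* 3ℤ)) n≡3m eq₁)

    -- The descent is a recursion on a bound k of ∣ n ∣. As 3 m ≤ k + 1 implies m ≤ k also for m =
    -- 0, the bound drops in every round and n = 0 needs no separate treatment.
    rootEquation⇒n≡0 : ∀ {i n} → RootEquation r s i n → n ≡ 0ℤ
    rootEquation⇒n≡0 {n = n} = go ℤ.∣ n ∣ ℕ.≤-refl
      where
      third : ∀ m {k} → m ℕ.* 3 ℕ.≤ suc k → m ℕ.≤ k
      third zero    _         = z≤n
      third (suc m) (s≤s le) = ℕ.≤-trans (s≤s (ℕ.m≤n⇒m≤1+n (ℕ.m≤m*n m 3))) le
      go : ∀ k {i n} → ℤ.∣ n ∣ ℕ.≤ k → RootEquation r s i n → n ≡ 0ℤ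
      go zero    ∣n∣≤0 eq = ℤ.∣i∣≡0⇒i≡0 (ℕ.n≤0⇒n≡0 ∣n∣≤0)
      go (suc k) {i} {n} ∣n∣≤k eq =
        let (j , m , n≡3m , eq′) = descent i n eq
            m≤k = third ℤ.∣ m ∣ (subst (ℕ._≤ suc k) (trans (cong ℤ.∣_∣ n≡3m) (ℤ.abs-* m 3ℤ)) ∣n∣≤k)
        in trans n≡3m (cong (ℤ._* 3ℤ) (go k {j} {m} m≤k eq′))

  ℤ⇒ℚ-* : ∀ i j → ℤ⇒ℚ (i ℤ.* j) ≡ ℤ⇒ℚ i ℚ.* ℤ⇒ℚ j
  ℤ⇒ℚ-* i j = ℚ.toℚᵘ-injective (ℚᵘ.≃-sym (ℚ.toℚᵘ-homo-* (ℤ⇒ℚ i) (ℤ⇒ℚ j)))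

  ℤ⇒ℚ-+ : ∀ i j → ℤ⇒ℚ (i ℤ.+ j) ≡ ℤ⇒ℚ i ℚ.+ ℤ⇒ℚ j
  ℤ⇒ℚ-+ i j = ℚ.toℚᵘ-injective (ℚᵘ.≃-trans
    (ℚᵘ.*≡* (cong (ℤ._* + 1) (sym (cong₂ ℤ._+_ (ℤ.*-identityʳ i) (ℤ.*-identityʳ j)))))
    (ℚᵘ.≃-sym (ℚ.toℚᵘ-homo-+ (ℤ⇒ℚ i) (ℤ⇒ℚ j))))

  ↥↧ : ∀ q → q ℚ.* ℤ⇒ℚ (ℚ.↧ q) ≡ ℤ⇒ℚ (ℚ.↥ q)
  ↥↧ q@record{} = ℚ.toℚᵘ-injective (ℚᵘ.≃-trans (ℚ.toℚᵘ-homo-* q (ℤ⇒ℚ (ℚ.↧ q)))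
    (ℚᵘ.*≡* (ℤ.*-assoc (ℚ.↥ q) (ℚ.↧ q) (+ 1))))

  ÷ℤ-* : ∀ i j .{{_ : ℤ.NonZero j}} → (i ÷ℤ j) ℚ.* ℤ⇒ℚ j ≡ ℤ⇒ℚ i
  ÷ℤ-* i j = trans (ℚ.*-assoc (ℤ⇒ℚ i) (ℚ.1/ ℤ⇒ℚ j) (ℤ⇒ℚ j))
    (trans (cong (ℤ⇒ℚ i ℚ.*_) (ℚ.*-inverseˡ (ℤ⇒ℚ j))) (ℚ.*-identityʳ (ℤ⇒ℚ i)))

  -- The quotient is stored in lowest terms, so its numerator need not be i; only the
  -- cross-multiplied form can be read off. Replacing the quotient by a variable q allows matching
  -- on it.
  ↥÷ℤ : ∀ i j .{{_ : ℤ.NonZero j}} → ℚ.↥ (i ÷ℤ j) ℤ.* j ≡ i ℤ.* ℚ.↧ (i ÷ℤ j)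
  ↥÷ℤ i j = cross (i ÷ℤ j) (÷ℤ-* i j)
    where
    cross : ∀ q → q ℚ.* ℤ⇒ℚ j ≡ ℤ⇒ℚ i → ℚ.↥ q ℤ.* j ≡ i ℤ.* ℚ.↧ q
    cross q@record{} eq with ℚᵘ.≃-trans (ℚᵘ.≃-sym (ℚ.toℚᵘ-homo-* q (ℤ⇒ℚ j))) (ℚᵘ.≃-reflexive (cong toℚᵘ eq))
    ... | ℚᵘ.*≡* e = trans (sym (ℤ.*-identityʳ _)) (trans e (cong (i ℤ.*_) (ℤ.*-identityʳ (ℚ.↧ q))))

  -- Multiplying by s n³, with n the denominator of q, turns the root equation into an equation
  -- between images of integers; taking numerators brings it back to ℤ.
  no-rational-root : ∀ r s .{{_ : ℤ.NonZero s}} → ¬ (3ℤ ℤ.∣ r) → ¬ (3ℤ ℤ.∣ s) →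
    ∀ q → ¬ (q ℚ.* q ℚ.* q ≡ (q ℚ.+ (q ℚ.+ q)) ℚ.+ (3ℤ ℤ.* r) ÷ℤ s)
  no-rational-root r s 3∤r 3∤s q root = ↧≢0 (rootEquation⇒n≡0 r s 3∤r 3∤s {i} {n} (cong ℚ.↥_ eq))
    where
    open ≡-Reasoning
    open +-*-Solver
    i n : ℤ
    i = ℚ.↥ q
    n = ℚ.↧ q
    A S I N : ℚ
    A = (3ℤ ℤ.* r) ÷ℤ s
    S = ℤ⇒ℚ s
    I = ℤ⇒ℚ i
    N = ℤ⇒ℚ n
    ↧≢0 : ¬ (n ≡ 0ℤ)
    ↧≢0 ()
    hom-cube : ∀ k i → ℤ⇒ℚ (k ℤ.* (i ℤ.* i ℤ.* i)) ≡ ℤ⇒ℚ k ℚ.* (ℤ⇒ℚ i ℚ.* ℤ⇒ℚ i ℚ.* ℤ⇒ℚ i)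
    hom-cube k i = trans (ℤ⇒ℚ-* k _)
        (cong (ℤ⇒ℚ k ℚ.*_) (trans (ℤ⇒ℚ-* (i ℤ.* i) i) (cong (ℚ._* ℤ⇒ℚ i) (ℤ⇒ℚ-* i i))))
    t : ℤ
    t = s ℤ.* i ℤ.* (n ℤ.* n)
    T : ℚ
    T = S ℚ.* I ℚ.* (N ℚ.* N)
    hom-t : ℤ⇒ℚ t ≡ T
    hom-t = trans (ℤ⇒ℚ-* (s ℤ.* i) (n ℤ.* n)) (cong₂ ℚ._*_ (ℤ⇒ℚ-* s i) (ℤ⇒ℚ-* n n))
    eq : ℤ⇒ℚ (s ℤ.* (i ℤ.* i ℤ.* i)) ≡ ℤ⇒ℚ (t ℤ.+ (t ℤ.+ t) ℤ.+ (3ℤ ℤ.* r) ℤ.* (n ℤ.* n ℤ.* n))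
    eq = begin
      ℤ⇒ℚ (s ℤ.* (i ℤ.* i ℤ.* i))
        ≡⟨ hom-cube s i ⟩
      S ℚ.* (I ℚ.* I ℚ.* I)
        ≡⟨ cong (λ I → S ℚ.* (I ℚ.* I ℚ.* I)) (↥↧ q) ⟨
      S ℚ.* ((q ℚ.* N) ℚ.* (q ℚ.* N) ℚ.* (q ℚ.* N))
        ≡⟨ solve 3 (λ S q N → S :* ((q :* N) :* (q :* N) :* (q :* N))
            := S :* (N :* N :* N) :* (q :* q :* q)) refl S q N ⟩
      S ℚ.* (N ℚ.* N ℚ.* N) ℚ.* (q ℚ.* q ℚ.* q)
        ≡⟨ cong (S ℚ.* (N ℚ.* N ℚ.* N) ℚ.*_) root ⟩
      S ℚ.* (N ℚ.* N ℚ.* N) ℚ.* ((q ℚ.+ (q ℚ.+ q)) ℚ.+ A)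
        ≡⟨ solve 4 (λ S q N A → S :* (N :* N :* N) :* ((q :+ (q :+ q)) :+ A) :=
              (S :* (q :* N) :* (N :* N) :+ (S :* (q :* N) :* (N :* N) :+ S :* (q :* N) :*
                  (N :* N))) :+ (A :* S) :* (N :* N :* N)) refl S q N A ⟩
      (S ℚ.* (q ℚ.* N) ℚ.* (N ℚ.* N) ℚ.+
          (S ℚ.* (q ℚ.* N) ℚ.* (N ℚ.* N) ℚ.+ S ℚ.* (q ℚ.* N) ℚ.* (N ℚ.* N))) ℚ.+ (A ℚ.* S) ℚ.*
          (N ℚ.* N ℚ.* N)
        ≡⟨ cong₂ (λ I R → (S ℚ.* I ℚ.* (N ℚ.* N) ℚ.+
            (S ℚ.* I ℚ.* (N ℚ.* N) ℚ.+ S ℚ.* I ℚ.* (N ℚ.* N))) ℚ.+ R ℚ.* (N ℚ.* N ℚ.* N)) (↥↧ q)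
            (÷ℤ-* (3ℤ ℤ.* r) s) ⟩
      (T ℚ.+ (T ℚ.+ T)) ℚ.+ ℤ⇒ℚ (3ℤ ℤ.* r) ℚ.* (N ℚ.* N ℚ.* N)
        ≡⟨ cong₂ ℚ._+_ (trans (cong (ℤ⇒ℚ t ℚ.+_) (ℤ⇒ℚ-+ t t)) (cong (λ T → T ℚ.+ (T ℚ.+ T)) hom-t))
            (hom-cube (3ℤ ℤ.* r) n) ⟨
      (ℤ⇒ℚ t ℚ.+ ℤ⇒ℚ (t ℤ.+ t)) ℚ.+ ℤ⇒ℚ ((3ℤ ℤ.* r) ℤ.* (n ℤ.* n ℤ.* n))
        ≡⟨ trans (ℤ⇒ℚ-+ (t ℤ.+ (t ℤ.+ t)) ((3ℤ ℤ.* r) ℤ.* (n ℤ.* n ℤ.* n)))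
            (cong (ℚ._+ ℤ⇒ℚ ((3ℤ ℤ.* r) ℤ.* (n ℤ.* n ℤ.* n))) (ℤ⇒ℚ-+ t (t ℤ.+ t))) ⟨
      ℤ⇒ℚ (t ℤ.+ (t ℤ.+ t) ℤ.+ (3ℤ ℤ.* r) ℤ.* (n ℤ.* n ℤ.* n)) ∎

module _ where
  open ≡
  open +-*-Solver
  open SemiringDefs ℚ[X] using (_∣_; mkIrred)

  -- Polynomials over ℚ

  coeff-+ : ∀ f g i → coeff (f +ᵖ g) i ≡ coeff f i ℚ.+ coeff g i
  coeff-+ []      g       i       = sym (ℚ.+-identityˡ _)
  coeff-+ (a ∷ f) []      i       = sym (ℚ.+-identityʳ _)
  coeff-+ (a ∷ f) (b ∷ g) zero    = refl
  coeff-+ (a ∷ f) (b ∷ g) (suc i) = coeff-+ f g i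

  coeff-map : ∀ a g i → coeff (map (a ℚ.*_) g) i ≡ a ℚ.* coeff g i
  coeff-map a []      i       = sym (ℚ.*-zeroʳ a)
  coeff-map a (b ∷ g) zero    = refl
  coeff-map a (b ∷ g) (suc i) = coeff-map a g i

  coeff-∷* : ∀ a f g i → coeff ((a ∷ f) *ᵖ g) i ≡ a ℚ.* coeff g i ℚ.+ coeff (0ℚ ∷ f *ᵖ g) i
  coeff-∷* a f g i = trans (coeff-+ (map (a ℚ.*_) g) _ i) (cong (ℚ._+ _) (coeff-map a g i))

  eval : Poly → ℚ → ℚ
  eval []      x = 0ℚ
  eval (a ∷ f) x = a ℚ.+ x ℚ.* eval f x

  eval-0 : ∀ f x → f ≈ᵖ [] → eval f x ≡ 0ℚ
  eval-0 []      x f≈0 = refl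
  eval-0 (a ∷ f) x f≈0 = trans (cong₂ (λ a e → a ℚ.+ x ℚ.* e) (f≈0 0) (eval-0 f x λ i → f≈0 (suc i)))
    (trans (ℚ.+-identityˡ _) (ℚ.*-zeroʳ x))

  eval-cong : ∀ f g x → f ≈ᵖ g → eval f x ≡ eval g x
  eval-cong []      g       x f≈g = sym (eval-0 g x λ i → sym (f≈g i))
  eval-cong (a ∷ f) []      x f≈g = eval-0 (a ∷ f) x f≈g
  eval-cong (a ∷ f) (b ∷ g) x f≈g = cong₂ (λ a e → a ℚ.+ x ℚ.* e) (f≈g 0)
      (eval-cong f g x λ i → f≈g (suc i))

  eval-+ : ∀ f g x → eval (f +ᵖ g) x ≡ eval f x ℚ.+ eval g x
  eval-+ []      g       x = sym (ℚ.+-identityˡ _)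
  eval-+ (a ∷ f) []      x = sym (ℚ.+-identityʳ _)
  eval-+ (a ∷ f) (b ∷ g) x = trans (cong (λ e → (a ℚ.+ b) ℚ.+ x ℚ.* e) (eval-+ f g x))
    (solve 5 (λ a b x e d → (a :+ b) :+ x :* (e :+ d) := (a :+ x :* e) :+ (b :+ x :* d)) refl a b x
        (eval f x) (eval g x))

  eval-map : ∀ a g x → eval (map (a ℚ.*_) g) x ≡ a ℚ.* eval g x
  eval-map a []      x = sym (ℚ.*-zeroʳ a)
  eval-map a (b ∷ g) x = trans (cong (λ e → a ℚ.* b ℚ.+ x ℚ.* e) (eval-map a g x))
    (solve 4 (λ a b x e → a :* b :+ x :* (a :* e) := a :* (b :+ x :* e)) refl a b x (eval g x))

  eval-* : ∀ f g x → eval (f *ᵖ g) x ≡ eval f x ℚ.* eval g x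
  eval-* []      g x = sym (ℚ.*-zeroˡ (eval g x))
  eval-* (a ∷ f) g x = trans (eval-+ (map (a ℚ.*_) g) (0ℚ ∷ f *ᵖ g) x)
    (trans (cong₂ (λ e d → e ℚ.+ (0ℚ ℚ.+ x ℚ.* d)) (eval-map a g x) (eval-* f g x))
      (solve 4 (λ a x e d → a :* d :+ (con 0ℚ :+ x :* (e :* d)) := (a :+ x :* e) :* d) refl a x
          (eval f x) (eval g x)))

  -- Trailing zeros make the length of the list useless, so the degree is a relation; the zero
  -- polynomial has none.
  record Degree (f : Poly) (n : ℕ) : Set where
    constructor degree
    field
      leading : ¬ (coeff f n ≡ 0ℚ)
      above   : ∀ {i} → n ℕ.< i → coeff f i ≡ 0ℚ

  open Degree

  degree? : ∀ f → f ≈ᵖ [] ⊎ ∃[ n ] Degree f n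
  degree? [] = inj₁ λ _ → refl
  degree? (a ∷ f) with degree? f
  ... | inj₂ (n , degree l h) = inj₂ (suc n , degree l λ { (s≤s n<i) → h n<i })
  ... | inj₁ f≈0 with a ℚ.≟ 0ℚ
  ...   | yes a≡0 = inj₁ λ { zero → a≡0 ; (suc i) → f≈0 i }
  ...   | no  a≢0 = inj₂ (0 , degree a≢0 λ { {suc i} _ → f≈0 i })

  Degree-unique : ∀ {f g m n} → f ≈ᵖ g → Degree f m → Degree g n → m ≡ n
  Degree-unique {m = m} {n} f≈g df dg = ℕ.≤-antisym
    (ℕ.≮⇒≥ λ n<m → leading df (trans (f≈g m) (above dg n<m)))
    (ℕ.≮⇒≥ λ m<n → leading dg (trans (sym (f≈g n)) (above df m<n)))

  Degree⇒≉0 : ∀ {f n} → Degree f n → ¬ (f ≈ᵖ [])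
  Degree⇒≉0 {n = n} df f≈0 = leading df (f≈0 n)

  *-zeroˡ : ∀ f g → f ≈ᵖ [] → f *ᵖ g ≈ᵖ []
  *-zeroˡ []      g f≈0 i = refl
  *-zeroˡ (a ∷ f) g f≈0 i = trans (coeff-∷* a f g i)
    (trans (cong₂ ℚ._+_ (trans (cong (ℚ._* coeff g i) (f≈0 0)) (ℚ.*-zeroˡ (coeff g i))) (tail i))
        (ℚ.+-identityʳ 0ℚ))
    where
    tail : ∀ i → coeff (0ℚ ∷ f *ᵖ g) i ≡ 0ℚ
    tail zero    = refl
    tail (suc i) = *-zeroˡ f g (λ i → f≈0 (suc i)) i

  *-zeroʳ : ∀ f g → g ≈ᵖ [] → f *ᵖ g ≈ᵖ []
  *-zeroʳ []      g g≈0 i = refl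
  *-zeroʳ (a ∷ f) g g≈0 i = trans (coeff-∷* a f g i)
    (trans (cong₂ ℚ._+_ (trans (cong (a ℚ.*_) (g≈0 i)) (ℚ.*-zeroʳ a)) (tail i)) (ℚ.+-identityʳ 0ℚ))
    where
    tail : ∀ i → coeff (0ℚ ∷ f *ᵖ g) i ≡ 0ℚ
    tail zero    = refl
    tail (suc i) = *-zeroʳ f g g≈0 i

  ℚ-integral : ∀ {p q} → p ℚ.* q ≡ 0ℚ → ¬ (p ≡ 0ℚ) → q ≡ 0ℚ
  ℚ-integral {p} {q} pq≡0 p≢0 = trans (sym (ℚ.*-identityˡ q))
    (trans (cong (ℚ._* q) (sym (ℚ.*-inverseˡ p)))
      (trans (ℚ.*-assoc (ℚ.1/ p) p q) (trans (cong (ℚ.1/ p ℚ.*_) pq≡0) (ℚ.*-zeroʳ (ℚ.1/ p)))))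
    where instance
      nonZero : ℚ.NonZero p
      nonZero = ℚ.≢-nonZero p≢0

  coeff-constant* : ∀ a f g → f ≈ᵖ [] → ∀ i → coeff ((a ∷ f) *ᵖ g) i ≡ a ℚ.* coeff g i
  coeff-constant* a f g f≈0 i = trans (coeff-∷* a f g i)
      (trans (cong (a ℚ.* coeff g i ℚ.+_) (tail i)) (ℚ.+-identityʳ _))
    where
    tail : ∀ i → coeff (0ℚ ∷ f *ᵖ g) i ≡ 0ℚ
    tail zero    = refl
    tail (suc i) = *-zeroˡ f g f≈0 i

  -- The summand `a` times `g` does not reach beyond index n, so above it the coefficients of the
  -- product are those of `f *ᵖ g`, moved up by one.
  Degree-* : ∀ {f g m n} → Degree f m → Degree g n → Degree (f *ᵖ g) (m ℕ.+ n)
  Degree-* {[]} df dg = ⊥-elim (leading df refl)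
  Degree-* {a ∷ f} {g} {zero} {n} df dg = degree
    (λ eq → leading dg (ℚ-integral (trans (sym (coeff-constant* a f g f≈0 n)) eq) (leading df)))
    (λ {i} n<i → trans (coeff-constant* a f g f≈0 i) (trans (cong (a ℚ.*_) (above dg n<i)) (ℚ.*-zeroʳ a)))
    where
    f≈0 : f ≈ᵖ []
    f≈0 i = above df (s≤s z≤n)
  Degree-* {a ∷ f} {g} {suc m} {n} df dg = degree
    (λ eq → leading fg (trans (sym (shift (s≤s (ℕ.m≤n+m n m)))) eq))
    (λ { {suc i} (s≤s m+n<i) → trans (shift (s≤s (ℕ.≤-trans (ℕ.m≤n+m n m) (ℕ.<⇒≤ m+n<i))))
        (above fg m+n<i) })
    where
    fg : Degree (f *ᵖ g) (m ℕ.+ n)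
    fg = Degree-* {f} {g} (degree (leading df) (λ m<i → above df (s≤s m<i))) dg
    shift : ∀ {i} → n ℕ.< suc i → coeff ((a ∷ f) *ᵖ g) (suc i) ≡ coeff (f *ᵖ g) i
    shift {i} n<1+i = trans (coeff-∷* a f g (suc i))
      (trans (cong (ℚ._+ coeff (f *ᵖ g) i) (trans (cong (a ℚ.*_) (above dg n<1+i)) (ℚ.*-zeroʳ a)))
          (ℚ.+-identityˡ _))

  degree-0⇒∣1 : ∀ {f} → Degree f 0 → f ∣ (1ℚ ∷ [])
  degree-0⇒∣1 {f} df = (ℚ.1/ coeff f 0 ∷ []) , λ where
      zero    → trans (coeff-constant* (ℚ.1/ coeff f 0) [] f (λ _ → refl) 0) (ℚ.*-inverseˡ (coeff f 0))
      (suc i) → trans (coeff-constant* (ℚ.1/ coeff f 0) [] f (λ _ → refl) (suc i))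
        (trans (cong (ℚ.1/ coeff f 0 ℚ.*_) (above df (s≤s z≤n))) (ℚ.*-zeroʳ (ℚ.1/ coeff f 0)))
    where instance
      nonZero : ℚ.NonZero (coeff f 0)
      nonZero = ℚ.≢-nonZero (leading df)

  degree-1⇒root : ∀ {f} → Degree f 1 → ∃[ x ] eval f x ≡ 0ℚ
  degree-1⇒root {f} df = x , trans
    (eval-cong f (b ∷ a ∷ []) x λ { zero → refl ; (suc zero) → refl ; (suc (suc i)) → above df
        (s≤s (s≤s z≤n)) })
    (trans (solve 3 (λ a b y → b :+ (:- (b :* y)) :* (a :+ (:- (b :* y)) :* con 0ℚ)
        := b :+ (:- b) :* (y :* a)) refl a b (ℚ.1/ a))
      (trans (cong (λ o → b ℚ.+ (ℚ.- b) ℚ.* o) (ℚ.*-inverseˡ a))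
        (trans (cong (b ℚ.+_) (ℚ.*-identityʳ (ℚ.- b))) (ℚ.+-inverseʳ b))))
    where
    a b : ℚ
    a = coeff f 1
    b = coeff f 0
    instance
      nonZero : ℚ.NonZero a
      nonZero = ℚ.≢-nonZero (leading df)
    x : ℚ
    x = ℚ.- (b ℚ.* ℚ.1/ a)

  module _ {a : ℚ} where

    Degree-p : Degree p[x, a ] 3
    Degree-p = degree (λ ()) λ { (s≤s (s≤s (s≤s (s≤s _)))) → refl }

    eval-p≡0⇒root : ∀ {x} → eval p[x, a ] x ≡ 0ℚ → x ℚ.* x ℚ.* x ≡ (x ℚ.+ (x ℚ.+ x)) ℚ.+ a
    eval-p≡0⇒root {x} eq = trans
      (solve 2 (λ x a → x :* x :* x :=
          (:- a :+ x :* (:- con (+ 3 ℚ./ 1) :+ x :* (con 0ℚ :+ x :* (con 1ℚ :+ x :* con 0ℚ)))) :+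
          ((x :+ (x :+ x)) :+ a)) refl x a)
      (trans (cong (ℚ._+ ((x ℚ.+ (x ℚ.+ x)) ℚ.+ a)) eq) (ℚ.+-identityˡ _))

    -- The degrees of two factors add up to 3, so one of them is 0 or 1. A factor of degree 0 is a
    -- unit, and one of degree 1 has a rational root, which would be a root of the cubic.
    irreducible : (∀ x → ¬ (x ℚ.* x ℚ.* x ≡ (x ℚ.+ (x ℚ.+ x)) ℚ.+ a)) → Irreducible p[x, a ]
    irreducible no-root = mkIrred p∤1 λ {f} {g} p≈fg → split f g p≈fg (degree? f) (degree? g)
      where
      p∤1 : ¬ (p[x, a ] ∣ (1ℚ ∷ []))
      p∤1 (q , qp≈1) with degree? q
      ... | inj₁ q≈0 = Degree⇒≉0 {1ℚ ∷ []} {0} (degree (λ ()) λ { (s≤s _) → refl })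
                         (λ i → trans (sym (qp≈1 i)) (*-zeroˡ q p[x, a ] q≈0 i))
      ... | inj₂ (n , dq) with Degree-unique qp≈1 (Degree-* dq Degree-p)
          (degree {1ℚ ∷ []} {0} (λ ()) λ { (s≤s _) → refl })
      ...   | n+3≡0 = ℕ.m+1+n≢0 n n+3≡0

      root-factor : ∀ f g → p[x, a ] ≈ᵖ f *ᵖ g → ∀ {x} → eval f x ℚ.* eval g x ≡ 0ℚ → ⊥
      root-factor f g p≈fg {x} eq = no-root x (eval-p≡0⇒root {x}
        (trans (eval-cong p[x, a ] (f *ᵖ g) x p≈fg) (trans (eval-* f g x) eq)))

      split : ∀ f g → p[x, a ] ≈ᵖ f *ᵖ g → f ≈ᵖ [] ⊎ ∃[ m ] Degree f m → g ≈ᵖ [] ⊎ ∃[ n ] Degree g n →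
        f ∣ (1ℚ ∷ []) ⊎ g ∣ (1ℚ ∷ [])
      split f g p≈fg (inj₁ f≈0) _ = ⊥-elim (Degree⇒≉0 Degree-p λ i → trans (p≈fg i) (*-zeroˡ f g f≈0 i))
      split f g p≈fg (inj₂ _) (inj₁ g≈0) = ⊥-elim
          (Degree⇒≉0 Degree-p λ i → trans (p≈fg i) (*-zeroʳ f g g≈0 i))
      split f g p≈fg (inj₂ (m , df))
          (inj₂ (n , dg)) with m | n | df | dg | Degree-unique p≈fg Degree-p (Degree-* df dg)
      ... | 0 | _ | df | _  | _ = inj₁ (degree-0⇒∣1 df)
      ... | _ | 0 | _  | dg | _ = inj₂ (degree-0⇒∣1 dg)
      ... | 1 | _ | df | _  | _ = let (x , fx≡0) = degree-1⇒root df in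
        ⊥-elim (root-factor f g p≈fg (trans (cong (ℚ._* eval g x) fx≡0) (ℚ.*-zeroˡ (eval g x))))
      ... | _ | 1 | _  | dg | _ = let (x , gx≡0) = degree-1⇒root dg in
        ⊥-elim (root-factor f g p≈fg (trans (cong (eval f x ℚ.*_) gx≡0) (ℚ.*-zeroʳ (eval f x))))
      ... | suc (suc m) | suc (suc n) | _ | _ | 3≡m+n = ⊥-elim (too-big m n 3≡m+n)
        where
        too-big : ∀ m n → ¬ (3 ≡ suc (suc m) ℕ.+ suc (suc n))
        too-big zero          n ()
        too-big (suc zero)    n ()
        too-big (suc (suc m)) n ()

module Reals {c ℓ₁ ℓ₂ : Level} (ℝ : RealNumbers c ℓ₁ ℓ₂) where

  open RealNumbers ℝ hiding (zero)
  open CommutativeRing commutativeRing using (ring; +-abelianGroup)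
  private module < = IsStrictPartialOrder isStrictPartialOrder
  open import Relation.Binary.Reasoning.Setoid setoid
  open SemiringDefs rawSemiring using (_×′_)
  open RingProperties ring using (-‿involutive; -0#≈0#; -‿distribˡ-*; -‿distribʳ-*)
  open AbelianGroupProperties +-abelianGroup using (⁻¹-∙-comm)
  open CommutativeSemigroupProperties (CommutativeRing.+-commutativeSemigroup commutativeRing)
    using (interchange)

  -- Integers in ℝ, and a ring solver with integer coefficients

  ι : ℤ → Carrier
  ι = ℤ⇒ℝ ℝ

  ·-homo-+ : ∀ m n → (m ℕ.+ n) · 1# ≈ m · 1# + n · 1#
  ·-homo-+ = Mult.×-homo-+ semiring 1#

  ·-homo-* : ∀ m n → (m ℕ.* n) · 1# ≈ (m · 1#) * (n · 1#)
  ·-homo-* = Mult.×1-homo-* semiring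

  ι-⊖ : ∀ m n → ι (m ℤ.⊖ n) ≈ m · 1# - n · 1#
  ι-⊖ m       zero    = sym (trans (+-congˡ -0#≈0#) (+-identityʳ _))
  ι-⊖ zero    (suc n) = sym (+-identityˡ _)
  ι-⊖ (suc m) (suc n) = begin
    ι (suc m ℤ.⊖ suc n)                    ≡⟨ ≡.cong ι (ℤ.[1+m]⊖[1+n]≡m⊖n m n) ⟩
    ι (m ℤ.⊖ n)                            ≈⟨ ι-⊖ m n ⟩
    m · 1# - n · 1#                        ≈⟨ +-identityˡ _ ⟨
    0# + (m · 1# - n · 1#)                 ≈⟨ +-congʳ (-‿inverseʳ 1#) ⟨
    (1# - 1#) + (m · 1# - n · 1#)          ≈⟨ interchange _ _ _ _ ⟩
    (1# + m · 1#) + (- 1# + - (n · 1#))    ≈⟨ +-congˡ (⁻¹-∙-comm _ _) ⟩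
    suc m · 1# - suc n · 1#                ∎

  ι-+ : ∀ i j → ι (i ℤ.+ j) ≈ ι i + ι j
  ι-+ (+ m)    (+ n)    = ·-homo-+ m n
  ι-+ (+ m)    -[1+ n ] = ι-⊖ m (suc n)
  ι-+ -[1+ m ] (+ n)    = trans (ι-⊖ n (suc m)) (+-comm _ _)
  ι-+ -[1+ m ] -[1+ n ] = begin
    - (suc (suc (m ℕ.+ n)) · 1#)     ≡⟨ ≡.cong (λ k → - (suc k · 1#)) (≡.sym (+-suc m n)) ⟩
    - ((suc m ℕ.+ suc n) · 1#)       ≈⟨ -‿cong (·-homo-+ (suc m) (suc n)) ⟩
    - (suc m · 1# + suc n · 1#)      ≈⟨ ⁻¹-∙-comm _ _ ⟨
    - (suc m · 1#) - suc n · 1#      ∎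
    where open import Data.Nat.Properties using (+-suc)

  ι-neg : ∀ i → ι (ℤ.- i) ≈ - ι i
  ι-neg +0       = sym -0#≈0#
  ι-neg +[1+ n ] = refl
  ι-neg -[1+ n ] = sym (-‿involutive _)

  ι-* : ∀ i j → ι (i ℤ.* j) ≈ ι i * ι j
  ι-* i j = go i j
    where
    pos : ∀ m n → ι (+ m ℤ.* + n) ≈ ι (+ m) * ι (+ n)
    pos m n = trans (reflexive (≡.cong ι (≡.sym (ℤ.pos-* m n)))) (·-homo-* m n)
    posˡ : ∀ m j → ι (+ m ℤ.* j) ≈ ι (+ m) * ι j
    posˡ m (+ n)    = pos m n
    posˡ m -[1+ n ] = begin
      ι (+ m ℤ.* ℤ.- + suc n)     ≡⟨ ≡.cong ι (ℤ.neg-distribʳ-* (+ m) (+ suc n)) ⟨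
      ι (ℤ.- (+ m ℤ.* + suc n))   ≈⟨ ι-neg (+ m ℤ.* + suc n) ⟩
      - ι (+ m ℤ.* + suc n)       ≈⟨ -‿cong (pos m (suc n)) ⟩
      - (ι (+ m) * ι (+ suc n))   ≈⟨ -‿distribʳ-* _ _ ⟩
      ι (+ m) * - ι (+ suc n)     ∎
    go : ∀ i j → ι (i ℤ.* j) ≈ ι i * ι j
    go (+ m)    j = posˡ m j
    go -[1+ m ] j = begin
      ι (ℤ.- + suc m ℤ.* j)       ≡⟨ ≡.cong ι (ℤ.neg-distribˡ-* (+ suc m) j) ⟨
      ι (ℤ.- (+ suc m ℤ.* j))     ≈⟨ ι-neg (+ suc m ℤ.* j) ⟩
      - ι (+ suc m ℤ.* j)         ≈⟨ -‿cong (posˡ (suc m) j) ⟩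
      - (ι (+ suc m) * ι j)       ≈⟨ -‿distribˡ-* _ _ ⟩
      - ι (+ suc m) * ι j         ∎

  -- ι up to _≈_, but sending + 1 to 1# by computation, so that the
  -- constants 1# and 1# + 1# are recognised by the solver.
  ι′ : ℤ → Carrier
  ι′ (+ n)    = n ×′ 1#
  ι′ -[1+ n ] = - (suc n ×′ 1#)

  ι≈ι′ : ∀ i → ι i ≈ ι′ i
  ι≈ι′ (+ n)    = Mult′.×ᵤ≈× semiring n 1#
  ι≈ι′ -[1+ n ] = -‿cong (Mult′.×ᵤ≈× semiring (suc n) 1#)

  private
    morphism : ℤ.+-*-rawRing -Raw-AlmostCommutative⟶ fromCommutativeRing commutativeRing
    morphism = record
      { ⟦_⟧    = ι′
      ; +-homo = λ i j → trans (sym (ι≈ι′ (i ℤ.+ j))) (trans (ι-+ i j) (+-cong (ι≈ι′ i) (ι≈ι′ j)))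
      ; *-homo = λ i j → trans (sym (ι≈ι′ (i ℤ.* j))) (trans (ι-* i j) (*-cong (ι≈ι′ i) (ι≈ι′ j)))
      ; -‿homo = λ i → trans (sym (ι≈ι′ (ℤ.- i))) (trans (ι-neg i) (-‿cong (ι≈ι′ i)))
      ; 0-homo = refl
      ; 1-homo = refl
      }

    _coefficient≟_ : ∀ i j → Maybe (ι′ i ≈ ι′ j)
    i coefficient≟ j with i ℤ.≟ j
    ... | yes i≡j = just (reflexive (≡.cong ι′ i≡j))
    ... | no  _   = nothing

  open Algebra.Solver.Ring ℤ.+-*-rawRing (fromCommutativeRing commutativeRing) morphism _coefficient≟_
    using (solve; _:=_; _:+_; _:*_; _:-_; :-_; con; _:^_; Polynomial)

  :1 : ∀ {n} → Polynomial n
  :1 = con (+ 1)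

  :0 : ∀ {n} → Polynomial n
  :0 = con (+ 0)

  -- Order and apartness

  -- By tightness `_≈_` is equivalent to the negation of `_#_`, and negations are stable.
  ≈-stable : ∀ {x y} → ¬ ¬ (x ≈ y) → x ≈ y
  ≈-stable ¬¬x≈y = proj₁ (tight _ _) λ x#y → ¬¬x≈y λ x≈y → proj₂ (tight _ _) x≈y x#y

  -- Refuting both strict inequalities refutes apartness, and then tightness gives equality. This is
  -- the case distinction available for negative goals.
  tri : ∀ x y → ¬ ¬ (x < y ⊎ x ≈ y ⊎ y < x)
  tri x y k = k (inj₂ (inj₁ (proj₁ (tight _ _) λ x#y → k (⊎-map (Equivalence.to #⇔<⊎> x#y)))))
    where
    ⊎-map : x < y ⊎ y < x → x < y ⊎ x ≈ y ⊎ y < x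
    ⊎-map (inj₁ p) = inj₁ p
    ⊎-map (inj₂ p) = inj₂ (inj₂ p)

  infix 4 _≤_
  _≤_ : Carrier → Carrier → Set ℓ₂
  x ≤ y = ¬ (y < x)

  ≤-respˡ : ∀ {x y z} → x ≈ y → x ≤ z → y ≤ z
  ≤-respˡ x≈y x≤z z<y = x≤z (<.<-respʳ-≈ (sym x≈y) z<y)

  ≤-respʳ : ∀ {x y z} → x ≈ y → z ≤ x → z ≤ y
  ≤-respʳ x≈y z≤x y<z = z≤x (<.<-respˡ-≈ (sym x≈y) y<z)

  <⇒≤ : ∀ {x y} → x < y → x ≤ y
  <⇒≤ x<y y<x = <.irrefl refl (<.trans x<y y<x)

  ≤-reflexive : ∀ {x y} → x ≈ y → x ≤ y
  ≤-reflexive x≈y y<x = <.irrefl (sym x≈y) y<x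

  <⇒0<- : ∀ {x y} → x < y → 0# < y - x
  <⇒0<- {x} {y} x<y = <.<-respˡ-≈ (-‿inverseˡ x) (<.<-respʳ-≈ (+-comm _ _) (+-monoʳ-< (- x) x<y))

  0<-⇒< : ∀ {x y} → 0# < y - x → x < y
  0<-⇒< {x} {y} 0<y-x = <.<-respˡ-≈ (+-identityʳ x)
    (<.<-respʳ-≈ (solve 2 (λ x y → x :+ (y :- x) := y) refl x y) (+-monoʳ-< x 0<y-x))

  0≤-⇒≤ : ∀ {x y} → 0# ≤ y - x → x ≤ y
  0≤-⇒≤ {x} {y} 0≤ y<x = 0≤ (0<-⇒<
      (<.<-respʳ-≈ (solve 2 (λ x y → x :- y := :0 :- (y :- x)) refl x y) (<⇒0<- y<x)))

  ≤⇒0≤- : ∀ {x y} → x ≤ y → 0# ≤ y - x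
  ≤⇒0≤- {x} {y} x≤y y-x<0 = x≤y (0<-⇒<
      (<.<-respʳ-≈ (solve 2 (λ x y → :0 :- (y :- x) := x :- y) refl x y) (<⇒0<- y-x<0)))

  0<x+y : ∀ {x y} → 0# < x → 0# < y → 0# < x + y
  0<x+y {x} {y} 0<x 0<y = <.trans 0<x (<.<-respˡ-≈ (+-identityʳ x) (+-monoʳ-< x 0<y))

  0≤x+y : ∀ {x y} → 0# ≤ x → 0# ≤ y → 0# ≤ x + y
  0≤x+y {x} {y} 0≤x 0≤y x+y<0 = tri 0# x λ where
    (inj₁ 0<x)        → 0≤y (<.trans
        (<.<-respˡ-≈ (+-identityˡ y) (<.<-respˡ-≈ (+-comm y 0#)
        (<.<-respʳ-≈ (+-comm y x) (+-monoʳ-< y 0<x)))) x+y<0)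
    (inj₂ (inj₁ 0≈x)) → 0≤y (<.<-respˡ-≈ (trans (+-congʳ (sym 0≈x)) (+-identityˡ y)) x+y<0)
    (inj₂ (inj₂ x<0)) → 0≤x x<0

  0≤x*y : ∀ {x y} → 0# ≤ x → 0# ≤ y → 0# ≤ x * y
  0≤x*y {x} {y} 0≤x 0≤y xy<0 = tri 0# x λ where
    (inj₂ (inj₂ x<0)) → 0≤x x<0
    (inj₂ (inj₁ 0≈x)) → <.irrefl refl (<.<-respˡ-≈ (trans (*-congʳ (sym 0≈x)) (zeroˡ y)) xy<0)
    (inj₁ 0<x)        → tri 0# y λ where
      (inj₁ 0<y)        → <⇒≤ (*-pos 0<x 0<y) xy<0
      (inj₂ (inj₂ y<0)) → 0≤y y<0
      (inj₂ (inj₁ 0≈y)) → <.irrefl refl (<.<-respˡ-≈ (trans (*-congˡ (sym 0≈y)) (zeroʳ x)) xy<0)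

  0≤x*x : ∀ x → 0# ≤ x * x
  0≤x*x x x*x<0 = tri 0# x λ where
    (inj₁ 0<x)        → 0≤x*y (<⇒≤ 0<x) (<⇒≤ 0<x) x*x<0
    (inj₂ (inj₁ 0≈x)) → <.irrefl refl (<.<-respˡ-≈ (trans (*-congʳ (sym 0≈x)) (zeroˡ x)) x*x<0)
    (inj₂ (inj₂ x<0)) → let 0≤0-x = ≤⇒0≤- (<⇒≤ x<0) in
      0≤x*y 0≤0-x 0≤0-x (<.<-respˡ-≈ (solve 1 (λ x → x :* x := (:0 :- x) :* (:0 :- x)) refl x) x*x<0)

  -- Inequalities are proved by certificates: z is an expression built from nonnegative parts, and
  -- the ring solver checks that it equals y - x.
  ≤-cert : ∀ {x y z} → 0# ≤ z → y - x ≈ z → x ≤ y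
  ≤-cert 0≤z eq = 0≤-⇒≤ (≤-respʳ (sym eq) 0≤z)

  ≤-trans : ∀ {x y z} → x ≤ y → y ≤ z → x ≤ z
  ≤-trans {x} {y} {z} x≤y y≤z = ≤-cert (0≤x+y (≤⇒0≤- x≤y) (≤⇒0≤- y≤z))
    (solve 3 (λ x y z → z :- x := (y :- x) :+ (z :- y)) refl x y z)

  +-mono-≤ : ∀ {x y u v} → x ≤ y → u ≤ v → x + u ≤ y + v
  +-mono-≤ {x} {y} {u} {v} x≤y u≤v = ≤-cert (0≤x+y (≤⇒0≤- x≤y) (≤⇒0≤- u≤v))
    (solve 4 (λ x y u v → (y :+ v) :- (x :+ u) := (y :- x) :+ (v :- u)) refl x y u v)

  *-monoˡ-≤ : ∀ {x y z} → 0# ≤ z → x ≤ y → z * x ≤ z * y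
  *-monoˡ-≤ {x} {y} {z} 0≤z x≤y = ≤-cert (0≤x*y 0≤z (≤⇒0≤- x≤y))
    (solve 3 (λ x y z → z :* y :- z :* x := z :* (y :- x)) refl x y z)

  ≤-antisym : ∀ {x y} → x ≤ y → y ≤ x → x ≈ y
  ≤-antisym {x} {y} x≤y y≤x = ≈-stable λ x≉y → tri x y λ where
    (inj₁ x<y)        → y≤x x<y
    (inj₂ (inj₁ x≈y)) → x≉y x≈y
    (inj₂ (inj₂ y<x)) → x≤y y<x

  0≤1 : 0# ≤ 1#
  0≤1 = <⇒≤ 0<1

  0≤n : ∀ n → 0# ≤ n · 1#
  0≤n zero    = ≤-reflexive refl
  0≤n (suc n) = <⇒≤ (0<1+n ℝ n)

  cancel-0≤ : ∀ {x y} → 0# < x → 0# ≤ x * y → 0# ≤ y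
  cancel-0≤ {x} {y} 0<x 0≤xy y<0 = 0≤xy (0<-⇒< (<.<-respʳ-≈
    (solve 2 (λ x y → x :* (:0 :- y) := :0 :- x :* y) refl x y) (*-pos 0<x (<⇒0<- y<0))))

  -- Inverting x takes apartness from 0, which `¬ (x ≈ 0#)` yields only under a double negation.
  inverse : ∀ {x} → ¬ (x ≈ 0#) → ¬ ¬ (∃[ y ] x * y ≈ 1#)
  inverse {x} x≉0 k = x≉0 (proj₁ (tight _ _) λ x#0 →
    let (y , _ , eq) = #⇒invertible x#0 in
    k (y , trans (solve 2 (λ x y → x :* y := (x :- :0) :* y) refl x y) eq))

  1≉0 : ¬ (1# ≈ 0#)
  1≉0 1≈0 = <.irrefl (sym 1≈0) 0<1

  integral : ∀ {x y} → x * y ≈ 0# → ¬ (x ≈ 0#) → y ≈ 0#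
  integral {x} {y} xy≈0 x≉0 = ≈-stable λ y≉0 → inverse x≉0 λ (z , xz≈1) → y≉0 (begin
    y            ≈⟨ *-identityˡ y ⟨
    1# * y       ≈⟨ *-congʳ xz≈1 ⟨
    (x * z) * y  ≈⟨ solve 3 (λ x y z → (x :* z) :* y := z :* (x :* y)) refl x y z ⟩
    z * (x * y)  ≈⟨ *-congˡ xy≈0 ⟩
    z * 0#       ≈⟨ zeroʳ z ⟩
    0#           ∎)

  1+n≉0 : ∀ n → ¬ (suc n · 1# ≈ 0#)
  1+n≉0 n eq = <.irrefl (sym eq) (0<1+n ℝ n)

  *-cancelˡ-1+n : ∀ n {x y} → suc n · 1# * x ≈ suc n · 1# * y → x ≈ y
  *-cancelˡ-1+n n {x} {y} eq = begin
    x            ≈⟨ solve 2 (λ x y → x := (x :- y) :+ y) refl x y ⟩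
    (x - y) + y  ≈⟨ +-congʳ (integral {suc n · 1#} (begin
       suc n · 1# * (x - y)                ≈⟨ solve 3
           (λ m x y → m :* (x :- y) := m :* x :- m :* y) refl (suc n · 1#) x y ⟩
       suc n · 1# * x - suc n · 1# * y     ≈⟨ +-congʳ eq ⟩
       suc n · 1# * y - suc n · 1# * y     ≈⟨ -‿inverseʳ _ ⟩
       0#                                  ∎) (1+n≉0 n)) ⟩
    0# + y       ≈⟨ +-identityˡ y ⟩
    y            ∎

  -- Series and their products

  Seq : Set c
  Seq = ℕ → Carrier

  shift : Seq → Seq
  shift a k = a (suc k)

  infix 4 _≈ₛ_
  _≈ₛ_ : Seq → Seq → Set ℓ₁
  a ≈ₛ b = ∀ k → a k ≈ b k

  Σ : ℕ → Seq → Carrier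
  Σ zero    a = 0#
  Σ (suc n) a = a 0 + Σ n (shift a)

  Σ-last : ∀ n a → Σ (suc n) a ≈ Σ n a + a n
  Σ-last zero    a = +-comm _ _
  Σ-last (suc n) a = trans (+-congˡ (Σ-last n (shift a))) (sym (+-assoc _ _ _))

  Σ-cong : ∀ n {a b} → a ≈ₛ b → Σ n a ≈ Σ n b
  Σ-cong zero    a≈b = refl
  Σ-cong (suc n) a≈b = +-cong (a≈b 0) (Σ-cong n λ k → a≈b (suc k))

  Σ-+ : ∀ n a b → Σ n (λ k → a k + b k) ≈ Σ n a + Σ n b
  Σ-+ zero    a b = sym (+-identityˡ 0#)
  Σ-+ (suc n) a b = trans (+-congˡ (Σ-+ n (shift a) (shift b)))
    (solve 4 (λ x y u v → (x :+ y) :+ (u :+ v) := (x :+ u) :+ (y :+ v)) refl _ _ _ _)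

  Σ-neg : ∀ n a → Σ n (λ k → - a k) ≈ - Σ n a
  Σ-neg zero    a = solve 0 (:0 := :- :0) refl
  Σ-neg (suc n) a = trans (+-congˡ (Σ-neg n (shift a)))
    (solve 2 (λ x u → :- x :+ :- u := :- (x :+ u)) refl _ _)

  -- The Cauchy product: the sum of all a i * b j with i + j = n, with recursion on the shifted
  -- first factor.
  conv : Seq → Seq → Seq
  conv a b zero    = a 0 * b 0
  conv a b (suc n) = a 0 * b (suc n) + conv (shift a) b n

  conv-cong : ∀ {a a′ b b′} → a ≈ₛ a′ → b ≈ₛ b′ → conv a b ≈ₛ conv a′ b′
  conv-cong p q zero    = *-cong (p 0) (q 0)
  conv-cong p q (suc n) = +-cong (*-cong (p 0) (q (suc n))) (conv-cong (λ k → p (suc k)) q n)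

  conv-*ˡ : ∀ x a b n → conv (λ k → x * a k) b n ≈ x * conv a b n
  conv-*ˡ x a b zero    = *-assoc _ _ _
  conv-*ˡ x a b (suc n) = trans (+-cong (*-assoc _ _ _) (conv-*ˡ x (shift a) b n)) (sym (distribˡ _ _ _))

  conv-*ʳ : ∀ x a b n → conv a (λ k → x * b k) n ≈ x * conv a b n
  conv-*ʳ x a b zero    = solve 3 (λ x a b → a :* (x :* b) := x :* (a :* b)) refl _ _ _
  conv-*ʳ x a b (suc n) = trans (+-congˡ (conv-*ʳ x (shift a) b n))
    (solve 4 (λ x a b t → a :* (x :* b) :+ x :* t := x :* (a :* b :+ t)) refl _ _ _ _)

  conv-0∷ˡ : ∀ a b → a 0 ≈ 0# → ∀ n → conv a b (suc n) ≈ conv (shift a) b n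
  conv-0∷ˡ a b a₀≈0 n = trans (+-congʳ (trans (*-congʳ a₀≈0) (zeroˡ _))) (+-identityˡ _)

  conv-0∷ʳ : ∀ a b → b 0 ≈ 0# → ∀ n → conv a b (suc n) ≈ conv a (shift b) n
  conv-0∷ʳ a b b₀≈0 zero    = trans (+-congˡ (trans (*-congˡ b₀≈0) (zeroʳ _))) (+-identityʳ _)
  conv-0∷ʳ a b b₀≈0 (suc n) = +-congˡ (conv-0∷ʳ (shift a) b b₀≈0 n)

  -- The coefficients of the derivative of the power series of a.
  D : Seq → Seq
  D a k = suc k · 1# * a (suc k)

  -- In every term a i * b j of the convolution n + p splits as (i + p) + j. The parameter p absorbs
  -- the 1 by which i is lowered when a is shifted in the induction.
  conv-weighted : ∀ n p a b →
    (n · 1# + p) * conv a b n ≈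
    conv (λ k → (k · 1# + p) * a k) b n + conv a (λ k → k · 1# * b k) n
  conv-weighted zero p a b =
    solve 3 (λ p a b → (:0 :+ p) :* (a :* b) := ((:0 :+ p) :* a) :* b :+ a :* (:0 :* b)) refl p _ _
  conv-weighted (suc n) p a b = begin
    ((1# + n · 1#) + p) * (a 0 * b (suc n) + conv (shift a) b n)
      ≈⟨ solve 5 (λ n p a b t → ((:1 :+ n) :+ p) :* (a :* b :+ t) :=
                    ((:1 :+ n) :+ p) :* (a :* b) :+ (n :+ (:1 :+ p)) :* t) refl _ _ _ _ _ ⟩
    ((1# + n · 1#) + p) * (a 0 * b (suc n)) + (n · 1# + (1# + p)) * conv (shift a) b n
      ≈⟨ +-congˡ (conv-weighted n (1# + p) (shift a) b) ⟩
    ((1# + n · 1#) + p) * (a 0 * b (suc n)) + (conv (λ k → (k · 1# + (1# + p)) * a (suc k)) b n + V)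
      ≈⟨ +-congˡ (+-congʳ (conv-cong
          (λ k → *-congʳ (solve 2 (λ k p → k :+ (:1 :+ p) := (:1 :+ k) :+ p) refl _ _)) (λ _ → refl) n)) ⟩
    ((1# + n · 1#) + p) * (a 0 * b (suc n)) + (U + V)
      ≈⟨ solve 6 (λ n p a b u v → ((:1 :+ n) :+ p) :* (a :* b) :+ (u :+ v) :=
                    (((:0 :+ p) :* a) :* b :+ u) :+ (a :* ((:1 :+ n) :* b) :+ v)) refl _ _ _ _ _ _ ⟩
    ((0# + p) * a 0) * b (suc n) + U + (a 0 * ((1# + n · 1#) * b (suc n)) + V) ∎
    where
    U V : Carrier
    U = conv (λ k → (suc k · 1# + p) * a (suc k)) b n
    V = conv (shift a) (λ k → k · 1# * b k) n

  -- In degree n + 1 the weights i and j of the two derivatives add up to n + 1. The terms of weight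
  -- 0 drop out, which shifts the index of the respective factor.
  conv-Leibniz : ∀ a b n → D (conv a b) n ≈ conv (D a) b n + conv a (D b) n
  conv-Leibniz a b n = begin
    suc n · 1# * conv a b (suc n)
      ≈⟨ *-congʳ (+-identityʳ _) ⟨
    (suc n · 1# + 0#) * conv a b (suc n)
      ≈⟨ conv-weighted (suc n) 0# a b ⟩
    conv (λ k → (k · 1# + 0#) * a k) b (suc n) + conv a (λ k → k · 1# * b k) (suc n)
      ≈⟨ +-cong (conv-0∷ˡ (λ k → (k · 1# + 0#) * a k) b (solve 1 (λ a → (:0 :+ :0) :* a := :0) refl _) n)
                (conv-0∷ʳ a (λ k → k · 1# * b k) (zeroˡ _) n) ⟩
    conv (λ k → (suc k · 1# + 0#) * a (suc k)) b n + conv a (D b) n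
      ≈⟨ +-congʳ (conv-cong (λ k → *-congʳ (+-identityʳ _)) (λ _ → refl) n) ⟩
    conv (D a) b n + conv a (D b) n ∎

  -- Δ a b n is the sum of all a i * b j with i + j < n.
  Δ : Seq → Seq → ℕ → Carrier
  Δ a b zero    = 0#
  Δ a b (suc n) = a 0 * Σ (suc n) b + Δ (shift a) b n

  Δ-last : ∀ a b n → Δ a b (suc n) ≈ Δ a b n + conv a b n
  Δ-last a b zero    = solve 2 (λ a b → a :* (b :+ :0) :+ :0 := :0 :+ a :* b) refl _ _
  Δ-last a b (suc n) = trans (+-cong (*-congˡ (Σ-last (suc n) b)) (Δ-last (shift a) b n))
    (solve 5 (λ a s b d v → a :* (s :+ b) :+ (d :+ v) := (a :* s :+ d) :+ (a :* b :+ v)) refl _ _ _ _ _)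

  Δ≈Σconv : ∀ a b n → Δ a b n ≈ Σ n (conv a b)
  Δ≈Σconv a b zero    = refl
  Δ≈Σconv a b (suc n) = trans (Δ-last a b n) (trans (+-congʳ (Δ≈Σconv a b n)) (sym (Σ-last n _)))

  -- Absolute bounds

  infix 4 ∣_∣≤_
  -- Two nonnegativity conditions stand in for the absolute value, so that the rules for sums and
  -- products reduce to ring identities.
  ∣_∣≤_ : Carrier → Carrier → Set ℓ₂
  ∣ x ∣≤ b = 0# ≤ b - x × 0# ≤ b + x

  bd-cong : ∀ {x y b d} → x ≈ y → b ≈ d → ∣ x ∣≤ b → ∣ y ∣≤ d
  bd-cong p q (l , u) = ≤-respʳ (+-cong q (-‿cong p)) l , ≤-respʳ (+-cong q p) u

  bd-0 : ∣ 0# ∣≤ 0#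
  bd-0 = ≤-reflexive (solve 0 (:0 := :0 :- :0) refl) , ≤-reflexive (solve 0 (:0 := :0 :+ :0) refl)

  bd-weaken : ∀ {x b d} → ∣ x ∣≤ b → b ≤ d → ∣ x ∣≤ d
  bd-weaken {x} {b} {d} (l , u) b≤d =
    ≤-respʳ (solve 3 (λ x b d → (d :- b) :+ (b :- x) := d :- x) refl x b d) (0≤x+y (≤⇒0≤- b≤d) l) ,
    ≤-respʳ (solve 3 (λ x b d → (d :- b) :+ (b :+ x) := d :+ x) refl x b d) (0≤x+y (≤⇒0≤- b≤d) u)

  bd-neg : ∀ {x b} → ∣ x ∣≤ b → ∣ - x ∣≤ b
  bd-neg {x} {b} (l , u) =
    ≤-respʳ (solve 2 (λ x b → b :+ x := b :- :- x) refl x b) u , l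

  bd-+ : ∀ {x y b d} → ∣ x ∣≤ b → ∣ y ∣≤ d → ∣ x + y ∣≤ b + d
  bd-+ {x} {y} {b} {d} (l , u) (l′ , u′) =
    ≤-respʳ (solve 4 (λ x y b d → (b :- x) :+ (d :- y) := (b :+ d) :- (x :+ y)) refl x y b d) (0≤x+y l l′) ,
    ≤-respʳ (solve 4 (λ x y b d → (b :+ x) :+ (d :+ y) := (b :+ d) :+ (x :+ y)) refl x y b d) (0≤x+y u u′)

  0<2 : 0# < 1# + 1#
  0<2 = 0<x+y 0<1 0<1

  -- Twice b d - x y is (b - x)(d + y) + (b + x)(d - y), a sum of products of nonnegative factors;
  -- changing the sign of y handles b d + x y.
  bd-* : ∀ {x y b d} → ∣ x ∣≤ b → ∣ y ∣≤ d → ∣ x * y ∣≤ b * d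
  bd-* {x} {y} {b} {d} (l , u) (l′ , u′) =
    cancel-0≤ 0<2 (≤-respʳ (solve 4 (λ x y b d → (b :- x) :* (d :+ y) :+ (b :+ x) :* (d :- y) :=
        (:1 :+ :1) :* (b :* d :- x :* y)) refl x y b d) (0≤x+y (0≤x*y l u′) (0≤x*y u l′))) ,
    cancel-0≤ 0<2 (≤-respʳ (solve 4 (λ x y b d → (b :- x) :* (d :- y) :+ (b :+ x) :* (d :+ y) :=
        (:1 :+ :1) :* (b :* d :+ x :* y)) refl x y b d) (0≤x+y (0≤x*y l l′) (0≤x*y u u′)))

  bd-cancel : ∀ {w x b} → 0# < w → ∣ w * x ∣≤ w * b → ∣ x ∣≤ b
  bd-cancel 0<w (l , u) =
    cancel-0≤ 0<w (≤-respʳ (solve 3 (λ w x b → w :* b :- w :* x := w :* (b :- x)) refl _ _ _) l) ,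
    cancel-0≤ 0<w (≤-respʳ (solve 3 (λ w x b → w :* b :+ w :* x := w :* (b :+ x)) refl _ _ _) u)

  bd-nonneg : ∀ {x} → 0# ≤ x → ∣ x ∣≤ x
  bd-nonneg 0≤x = ≤-reflexive (sym (-‿inverseʳ _)) , 0≤x+y 0≤x 0≤x

  Dominated : Seq → Seq → Set ℓ₂
  Dominated a A = ∀ k → ∣ a k ∣≤ A k

  Σ-bd : ∀ n {a A} → Dominated a A → ∣ Σ n a ∣≤ Σ n A
  Σ-bd zero    dom = bd-0
  Σ-bd (suc n) dom = bd-+ (dom 0) (Σ-bd n λ k → dom (suc k))

  Σ-tail-bd : ∀ {m n a A} → m ℕ.≤ n → Dominated a A → ∣ Σ n a - Σ m a ∣≤ Σ n A - Σ m A
  Σ-tail-bd {n = n} z≤n dom = bd-cong x-0 x-0 (Σ-bd n dom)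
    where
    x-0 : ∀ {x} → x ≈ x - 0#
    x-0 {x} = solve 1 (λ x → x := x :- :0) refl x
  Σ-tail-bd (s≤s m≤n) dom = bd-cong cancel cancel (Σ-tail-bd m≤n λ k → dom (suc k))
    where
    cancel : ∀ {x y z} → y - z ≈ (x + y) - (x + z)
    cancel {x} {y} {z} = solve 3 (λ x y z → y :- z := (x :+ y) :- (x :+ z)) refl x y z

  -- As m ≤ n, the difference consists of the terms a i * b j with i < m, j < n and m ≤ i + j, and
  -- these are dominated one by one.
  product-bd : ∀ {m n a b A B} → m ℕ.≤ n → Dominated a A → Dominated b B →
    ∣ Σ m a * Σ n b - Δ a b m ∣≤ Σ m A * Σ n B - Δ A B m
  product-bd {zero} m≤n domA domB = bd-cong 0*y-0 0*y-0 bd-0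
    where
    0*y-0 : ∀ {y} → 0# ≈ 0# * y - 0#
    0*y-0 {y} = solve 1 (λ y → :0 := :0 :* y :- :0) refl y
  product-bd {suc m} m<n domA domB = bd-cong split split
    (bd-+ (bd-* (domA 0) (Σ-tail-bd m<n domB))
          (product-bd {m} (ℕ.<⇒≤ m<n) (λ k → domA (suc k)) domB))
    where
    split : ∀ {x s t u d} → x * (t - u) + (s * t - d) ≈ (x + s) * t - (x * u + d)
    split {x} {s} {t} {u} {d} = solve 5 (λ x s t u d →
      x :* (t :- u) :+ (s :* t :- d) := (x :+ s) :* t :- (x :* u :+ d)) refl x s t u d

  NonNegative : Seq → Set ℓ₂
  NonNegative a = ∀ k → 0# ≤ a k

  Σ-nonneg : ∀ n {a} → NonNegative a → 0# ≤ Σ n a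
  Σ-nonneg zero    a≥0 = ≤-reflexive refl
  Σ-nonneg (suc n) a≥0 = 0≤x+y (a≥0 0) (Σ-nonneg n λ k → a≥0 (suc k))

  Δ-nonneg : ∀ n {a b} → NonNegative a → NonNegative b → 0# ≤ Δ a b n
  Δ-nonneg zero    a≥0 b≥0 = ≤-reflexive refl
  Δ-nonneg (suc n) a≥0 b≥0 = 0≤x+y (0≤x*y (a≥0 0) (Σ-nonneg (suc n) b≥0))
      (Δ-nonneg n (λ k → a≥0 (suc k)) b≥0)

  Σ-mono : ∀ {m n a} → NonNegative a → m ℕ.≤ n → 0# ≤ Σ n a - Σ m a
  Σ-mono {n = n} a≥0 z≤n = ≤-respʳ (solve 1 (λ x → x := x :- :0) refl _) (Σ-nonneg n a≥0)
  Σ-mono a≥0 (s≤s m≤n) = ≤-respʳ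
    (solve 3 (λ x y z → y :- z := (x :+ y) :- (x :+ z)) refl _ _ _) (Σ-mono (λ k → a≥0 (suc k)) m≤n)

  -- All pairs i < m, j < n have i + j < m + n, so the product is a part of a sum of nonnegative
  -- terms.
  product≤Δ : ∀ m n {a b} → NonNegative a → NonNegative b → Σ m a * Σ n b ≤ Δ a b (m ℕ.+ n)
  product≤Δ zero    n a≥0 b≥0 = ≤-respˡ (sym (zeroˡ _)) (Δ-nonneg n a≥0 b≥0)
  product≤Δ (suc m) n {a} {b} a≥0 b≥0 = ≤-cert
    (0≤x+y (0≤x*y (a≥0 0) (Σ-mono b≥0 (ℕ.m≤n⇒m≤1+n (ℕ.m≤n+m n m))))
           (≤⇒0≤- (product≤Δ m n (λ k → a≥0 (suc k)) b≥0)))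
    (solve 5 (λ x s t u d → (x :* u :+ d) :- (x :+ s) :* t := x :* (u :- t) :+ (d :- s :* t)) refl
       (a 0) (Σ m (shift a)) (Σ n b) (Σ (suc m ℕ.+ n) b) (Δ (shift a) b (m ℕ.+ n)))

  -- The terms a i * b j with i , j < n ≤ i + j satisfy i + j < 2n.
  product-remainder : ∀ n {a b A B} → Dominated a A → Dominated b B → NonNegative A → NonNegative B →
    ∣ Σ n a * Σ n b - Σ n (conv a b) ∣≤ Σ (n ℕ.+ n) (conv A B) - Σ n (conv A B)
  product-remainder n {a} {b} {A} {B} domA domB A≥0 B≥0 =
    bd-cong (+-congˡ (-‿cong (Δ≈Σconv a b n))) refl
      (bd-weaken (product-bd (ℕ.≤-refl {n}) domA domB)
        (+-mono-≤ (≤-respʳ (Δ≈Σconv A B (n ℕ.+ n)) (product≤Δ n n A≥0 B≥0))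
                  (≤-reflexive (-‿cong (Δ≈Σconv A B n)))))

  -- Limits

  -- Eventually ∣ u n ∣ ≤ 1 / k, for every k.
  Null : Seq → Set ℓ₂
  Null u = ∀ k → ∃[ N ] ∀ n → N ℕ.≤ n → ∣ k · 1# * u n ∣≤ 1#

  Null-cong : ∀ {u v} → u ≈ₛ v → Null u → Null v
  Null-cong u≈v null k = let (N , h) = null k in
    N , λ n N≤n → bd-cong (*-congˡ (u≈v n)) refl (h n N≤n)

  Null-neg : ∀ {u} → Null u → Null (λ n → - u n)
  Null-neg null k = let (N , h) = null k in
    N , λ n N≤n → bd-cong (solve 2 (λ k u → :- (k :* u) := k :* :- u) refl _ _) refl (bd-neg (h n N≤n))

  Null-+ : ∀ {u v} → Null u → Null v → Null (λ n → u n + v n)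
  Null-+ {u} {v} nu nv k =
    let (M , f) = nu (k ℕ.+ k) ; (N , g) = nv (k ℕ.+ k) in
    M ℕ.⊔ N , λ n M⊔N≤n → bd-cancel 0<2
      (bd-cong (trans (+-cong (*-congʳ (·-homo-+ k k)) (*-congʳ (·-homo-+ k k)))
                      (solve 3 (λ k u v → (k :+ k) :* u :+ (k :+ k) :* v
                          := (:1 :+ :1) :* (k :* (u :+ v))) refl _ _ _))
               (sym (*-identityʳ _))
        (bd-+ (f n (ℕ.≤-trans (ℕ.m≤m⊔n M N) M⊔N≤n)) (g n (ℕ.≤-trans (ℕ.m≤n⊔m M N) M⊔N≤n))))

  Null-* : ∀ {u v} → Null u → Null v → Null (λ n → u n * v n)
  Null-* nu nv k =
    let (M , f) = nu k ; (N , g) = nv 1 in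
    M ℕ.⊔ N , λ n M⊔N≤n →
      bd-cong (solve 3 (λ k u v → (k :* u) :* ((:1 :+ :0) :* v) := k :* (u :* v)) refl _ _ _)
          (*-identityˡ 1#)
        (bd-* (f n (ℕ.≤-trans (ℕ.m≤m⊔n M N) M⊔N≤n)) (g n (ℕ.≤-trans (ℕ.m≤n⊔m M N) M⊔N≤n)))

  bounded : ∀ x → ∃[ b ] ∣ x ∣≤ suc b · 1#
  bounded x =
    let (m , x<m) = archimedean x ; (n , -x<n) = archimedean (- x) in
    m ℕ.+ n ,
    ≤-respʳ (trans (solve 3 (λ x m n → (:1 :+ n) :+ (m :- x) := (:1 :+ (m :+ n)) :- x) refl _ _ _)
        (+-congʳ (+-congˡ (sym (·-homo-+ m n)))))
      (0≤x+y (0≤x+y 0≤1 (0≤n n)) (<⇒≤ (<⇒0<- x<m))) ,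
    ≤-respʳ (trans (solve 3 (λ x m n → (:1 :+ m) :+ (n :- :- x)
        := (:1 :+ (m :+ n)) :+ x) refl _ _ _) (+-congʳ (+-congˡ (sym (·-homo-+ m n)))))
      (0≤x+y (0≤x+y 0≤1 (0≤n m)) (<⇒≤ (<⇒0<- -x<n)))

  Null-*-const : ∀ {u} x → Null u → Null (λ n → u n * x)
  Null-*-const {u} x nu k =
    let (b , ∣x∣≤b) = bounded x ; (N , f) = nu (suc b ℕ.* k) in
    N , λ n N≤n → bd-cancel (0<1+n ℝ b)
      (bd-cong (trans (*-congʳ (*-congʳ (·-homo-* (suc b) k)))
                      (solve 4 (λ b k u x → ((b :* k) :* u) :* x := b :* (k :* (u :* x))) refl
                          (suc b · 1#) (k · 1#) (u n) x))
               (*-comm _ _)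
        (bd-* (f n N≤n) ∣x∣≤b))

  -- If x is positive with inverse y, a natural number k > y gives k x > x y = 1, contrary to the
  -- bound; a negative x is treated through - x.
  Null-const : ∀ {x} → Null (λ _ → x) → x ≈ 0#
  Null-const {x} null = ≈-stable λ x≉0 → tri 0# x λ where
      (inj₁ 0<x)        → not-pos null 0<x
      (inj₂ (inj₁ 0≈x)) → x≉0 (sym 0≈x)
      (inj₂ (inj₂ x<0)) → not-pos (Null-neg null)
        (<.<-respʳ-≈ (solve 1 (λ x → :0 :- x := :- x) refl x) (<⇒0<- x<0))
    where
    not-pos : ∀ {x} → Null (λ _ → x) → ¬ (0# < x)
    not-pos {x} null 0<x = inverse {x} (λ x≈0 → <.irrefl (sym x≈0) 0<x) λ (y , xy≈1) →
      let (k , y<k) = archimedean y ; (N , f) = null k in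
      proj₁ (f N ℕ.≤-refl) (0<-⇒< (<.<-respʳ-≈
        (begin
          (k · 1# - y) * x       ≈⟨ solve 3 (λ k y x → (k :- y) :* x := k :* x :- x :* y) refl _ _ _ ⟩
          k · 1# * x - x * y     ≈⟨ +-congˡ (-‿cong xy≈1) ⟩
          k · 1# * x - 1#        ≈⟨ solve 2 (λ a b → a :- b := :0 :- (b :- a)) refl _ _ ⟩
          0# - (1# - k · 1# * x) ∎)
        (*-pos (<⇒0<- y<k) 0<x)))

  infix 4 _⇝_
  _⇝_ : Seq → Carrier → Set ℓ₂
  u ⇝ l = Null (λ n → u n - l)

  ⇝-cong : ∀ {u v l} → u ≈ₛ v → u ⇝ l → v ⇝ l
  ⇝-cong u≈v = Null-cong (λ n → +-congʳ (u≈v n))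

  ⇝-unique : ∀ {u l m} → u ⇝ l → u ⇝ m → l ≈ m
  ⇝-unique {u} {l} {m} u⇝l u⇝m = begin
    l            ≈⟨ solve 2 (λ l m → l := (l :- m) :+ m) refl l m ⟩
    (l - m) + m  ≈⟨ +-congʳ (Null-const (Null-cong
                     (λ n → solve 3 (λ u l m → (u :- m) :+ :- (u :- l) := l :- m) refl _ _ _)
                     (Null-+ u⇝m (Null-neg u⇝l)))) ⟩
    0# + m       ≈⟨ +-identityˡ m ⟩
    m            ∎

  ⇝-+ : ∀ {u v l m} → u ⇝ l → v ⇝ m → (λ n → u n + v n) ⇝ (l + m)
  ⇝-+ u⇝l v⇝m = Null-cong (λ n → solve 4
      (λ u v l m → (u :- l) :+ (v :- m) := (u :+ v) :- (l :+ m)) refl _ _ _ _)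
    (Null-+ u⇝l v⇝m)

  ⇝-neg : ∀ {u l} → u ⇝ l → (λ n → - u n) ⇝ (- l)
  ⇝-neg u⇝l = Null-cong (λ n → solve 2 (λ u l → :- (u :- l) := :- u :- :- l) refl _ _) (Null-neg u⇝l)

  ⇝-* : ∀ {u v l m} → u ⇝ l → v ⇝ m → (λ n → u n * v n) ⇝ (l * m)
  ⇝-* {l = l} {m} u⇝l v⇝m = Null-cong
    (λ n → solve 4 (λ u v l m → ((u :- l) :* (v :- m) :+ (u :- l) :* m) :+ (v :- m) :* l
        := u :* v :- l :* m) refl _ _ _ _)
    (Null-+ (Null-+ (Null-* u⇝l v⇝m) (Null-*-const m u⇝l)) (Null-*-const l v⇝m))

  ⇝-near : ∀ {u v l} → Null (λ n → u n - v n) → u ⇝ l → v ⇝ l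
  ⇝-near near u⇝l = Null-cong (λ n → solve 3 (λ u v l → (u :- l) :+ :- (u :- v) := v :- l) refl _ _ _)
    (Null-+ u⇝l (Null-neg near))

  1/1+-inverse : ∀ n → suc n · 1# * 1/1+ ℝ n ≈ 1#
  1/1+-inverse n = trans (*-congʳ (solve 1 (λ x → x := x :- :0) refl _))
    (proj₂ (proj₂ (#⇒invertible (Equivalence.from #⇔<⊎> (inj₂ (0<1+n ℝ n))))))

  -- The tolerance ε = 1 / (k + 1) also makes sense for k = 0, and k ε = 1 - ε ≤ 1.
  ⟶⇒⇝ : ∀ {u l} → u ⟶ l → u ⇝ l
  ⟶⇒⇝ {u} {l} u⟶l k = let (N , f) = u⟶l ε 0<ε in
    N , λ n N≤n → let (-ε<d , d<ε) = f n N≤n in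
      bd-weaken
        (bd-* (bd-nonneg (0≤n k)) (<⇒≤ (<⇒0<- d<ε) ,
          ≤-respʳ (solve 2 (λ d e → d :- :- e := e :+ d) refl _ _) (<⇒≤ (<⇒0<- -ε<d))))
        (≤-cert (<⇒≤ 0<ε) (trans (+-congʳ (sym (1/1+-inverse k)))
          (solve 2 (λ k e → (:1 :+ k) :* e :- k :* e := e) refl _ _)))
    where
    ε : Carrier
    ε = 1/1+ ℝ k
    0<ε : 0# < ε
    0<ε with Equivalence.to #⇔<⊎> (invertible⇒#
        (suc k · 1# , trans ε-0≈ (1/1+-inverse k) , trans (*-comm _ _) (trans ε-0≈ (1/1+-inverse k))))
      where
      ε-0≈ : suc k · 1# * (ε - 0#) ≈ suc k · 1# * ε
      ε-0≈ = *-congˡ (solve 1 (λ x → x :- :0 := x) refl ε)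
    ... | inj₂ 0<ε = 0<ε
    ... | inj₁ ε<0 = ⊥-elim (0≤1 (0<-⇒< (<.<-respʳ-≈
      (trans (solve 2 (λ m x → m :* (:0 :- x) := :0 :- m :* x) refl (suc k · 1#) ε)
          (+-congˡ (-‿cong (1/1+-inverse k))))
      (*-pos (0<1+n ℝ k) (<⇒0<- ε<0)))))

  ℚ⇒ℝ-* : ∀ q → ℚ⇒ℝ ℝ q * ι (ℚ.↧ q) ≈ ι (ℚ.↥ q)
  ℚ⇒ℝ-* q@record{} = begin
    (ι (ℚ.↥ q) * 1/1+ ℝ d) * (suc d · 1#)  ≈⟨ solve 3
        (λ i r n → (i :* r) :* n := i :* (n :* r)) refl _ _ _ ⟩
    ι (ℚ.↥ q) * (suc d · 1# * 1/1+ ℝ d)    ≈⟨ *-congˡ (1/1+-inverse d) ⟩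
    ι (ℚ.↥ q) * 1#                         ≈⟨ *-identityʳ _ ⟩
    ι (ℚ.↥ q)                              ∎
    where
    d : ℕ
    d = ℚ.denominator-1 q

  -- `i / n` is reduced to lowest terms; multiplying by the gcd g recovers i and n.
  ℚ⇒ℝ-/ : ∀ i n .{{_ : ℕ.NonZero n}} → ℚ⇒ℝ ℝ (i ℚ./ n) * (n · 1#) ≈ ι i
  ℚ⇒ℝ-/ i n = begin
    ℚ⇒ℝ ℝ q * ι (+ n)               ≡⟨ ≡.cong (λ j → ℚ⇒ℝ ℝ q * ι j) (ℚ.↧-/ i n) ⟨
    ℚ⇒ℝ ℝ q * ι (ℚ.↧ q ℤ.* g)       ≈⟨ *-congˡ (ι-* (ℚ.↧ q) g) ⟩
    ℚ⇒ℝ ℝ q * (ι (ℚ.↧ q) * ι g)     ≈⟨ *-assoc _ _ _ ⟨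
    ℚ⇒ℝ ℝ q * ι (ℚ.↧ q) * ι g       ≈⟨ *-congʳ (ℚ⇒ℝ-* q) ⟩
    ι (ℚ.↥ q) * ι g                 ≈⟨ ι-* (ℚ.↥ q) g ⟨
    ι (ℚ.↥ q ℤ.* g)                 ≡⟨ ≡.cong ι (ℚ.↥-/ i n) ⟩
    ι i                             ∎
    where
    q : ℚ
    q = i ℚ./ n
    g : ℤ
    g = ℤ.gcd i (+ n)

  -- Exponential and trigonometric series

  -- With a regarded as the coefficients of a power series f, `step` says f′ = x f; the solution
  -- with f(0) = 1 has the coefficients x^k / k!.
  record IsExp (x : Carrier) (a : Seq) : Set ℓ₁ where
    constructor isExp
    field
      init : a 0 ≈ 1#
      step : ∀ k → D a k ≈ x * a k

  -- (c , s) are the terms of the real and imaginary part of the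
  -- exponential series of ix.
  record IsTrig (x : Carrier) (c s : Seq) : Set ℓ₁ where
    constructor isTrig
    field
      initᶜ : c 0 ≈ 1#
      initˢ : s 0 ≈ 0#
      stepᶜ : ∀ k → D c k ≈ - x * s k
      stepˢ : ∀ k → D s k ≈ x * c k

  D-conv : ∀ {x y a a′ b b′} → (∀ k → D a k ≈ x * a′ k) → (∀ k → D b k ≈ y * b′ k) →
    ∀ k → D (conv a b) k ≈ x * conv a′ b k + y * conv a b′ k
  D-conv {x} {y} {a} {a′} {b} {b′} p q k = trans (conv-Leibniz a b k)
    (+-cong (trans (conv-cong p (λ _ → refl) k) (conv-*ˡ x a′ b k))
            (trans (conv-cong (λ _ → refl) q k) (conv-*ʳ y a b′ k)))

  exp-conv : ∀ {x y a b} → IsExp x a → IsExp y b → IsExp (x + y) (conv a b)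
  exp-conv (isExp a₀ p) (isExp b₀ q) = isExp
    (trans (*-cong a₀ b₀) (*-identityˡ 1#))
    (λ k → trans (D-conv p q k) (sym (distribʳ _ _ _)))

  exp-cong : ∀ {x y a} → x ≈ y → IsExp x a → IsExp y a
  exp-cong x≈y (isExp a₀ p) = isExp a₀ (λ k → trans (p k) (*-congʳ x≈y))

  exp-nonneg : ∀ {x a} → 0# ≤ x → IsExp x a → NonNegative a
  exp-nonneg 0≤x (isExp a₀ p) zero    = ≤-respʳ (sym a₀) 0≤1
  exp-nonneg 0≤x e@(isExp a₀ p) (suc k) =
    cancel-0≤ (0<1+n ℝ k) (≤-respʳ (sym (p k)) (0≤x*y 0≤x (exp-nonneg 0≤x e k)))

  -- The recurrences determine each next term because k + 1 can be cancelled. This identifies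
  -- convolutions with the series of x + y.
  trig-unique : ∀ {x c s c′ s′} → IsTrig x c s → IsTrig x c′ s′ → ∀ k → c k ≈ c′ k × s k ≈ s′ k
  trig-unique t t′ zero = trans (initᶜ t) (sym (initᶜ t′)) , trans (initˢ t) (sym (initˢ t′))
    where open IsTrig
  trig-unique t t′ (suc k) = let (p , q) = trig-unique t t′ k in
    *-cancelˡ-1+n k (trans (stepᶜ t k) (trans (*-congˡ q) (sym (stepᶜ t′ k)))) ,
    *-cancelˡ-1+n k (trans (stepˢ t k) (trans (*-congˡ p) (sym (stepˢ t′ k))))
    where open IsTrig

  trig-cong : ∀ {x y c s} → x ≈ y → IsTrig x c s → IsTrig y c s
  trig-cong x≈y (isTrig c₀ s₀ p q) = isTrig c₀ s₀
    (λ k → trans (p k) (*-congʳ (-‿cong x≈y))) (λ k → trans (q k) (*-congʳ x≈y))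

  trig-neg : ∀ {x c s} → IsTrig x c s → IsTrig (- x) c (λ k → - s k)
  trig-neg (isTrig c₀ s₀ p q) = isTrig c₀ (trans (-‿cong s₀) (solve 0 (:- :0 := :0) refl))
    (λ k → trans (p k) (solve 2 (λ x s → :- x :* s := :- :- x :* :- s) refl _ _))
    (λ k → trans (solve 2 (λ n s → n :* :- s := :- (n :* s)) refl _ _)
      (trans (-‿cong (q k)) (solve 2 (λ x s → :- (x :* s) := :- x :* s) refl _ _)))

  -- These are the real and imaginary part of the product of the exponential series of ix and iy.
  trig-conv : ∀ {x y c s c′ s′} → IsTrig x c s → IsTrig y c′ s′ →
    IsTrig (x + y) (λ k → conv c c′ k + - conv s s′ k) (λ k → conv s c′ k + conv c s′ k)
  trig-conv (isTrig c₀ s₀ p q) (isTrig c₀′ s₀′ p′ q′) = isTrig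
    (trans (+-cong (*-cong c₀ c₀′) (-‿cong (*-cong s₀ s₀′)))
        (solve 0 (:1 :* :1 :+ :- (:0 :* :0) := :1) refl))
    (trans (+-cong (*-cong s₀ c₀′) (*-cong c₀ s₀′)) (solve 0 (:0 :* :1 :+ :1 :* :0 := :0) refl))
    (λ k → trans (solve 3 (λ n u v → n :* (u :+ :- v) := n :* u :+ :- (n :* v)) refl _ _ _)
      (trans (+-cong (D-conv p p′ k) (-‿cong (D-conv q q′ k)))
        (solve 4 (λ x y u v → (:- x :* u :+ :- y :* v) :+ :- (x :* v :+ y :* u)
            := :- (x :+ y) :* (u :+ v)) refl _ _ _ _)))
    (λ k → trans (distribˡ _ _ _)
      (trans (+-cong (D-conv q p′ k) (D-conv p q′ k))
        (solve 4 (λ x y u v → (x :* u :+ :- y :* v) :+ (:- x :* v :+ y :* u)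
            := (x :+ y) :* (u :+ :- v)) refl _ _ _ _)))

  -- The recurrence of E has the factor z where those of c and s have x up to sign, so the two
  -- bounds pass together from k to k + 1.
  trig-dominated : ∀ {x c s z E} → IsTrig x c s → ∣ x ∣≤ z → IsExp z E →
    ∀ k → ∣ c k ∣≤ E k × ∣ s k ∣≤ E k
  trig-dominated (isTrig c₀ s₀ p q) ∣x∣≤z (isExp e₀ r) zero =
    bd-cong (sym c₀) (sym e₀) (bd-nonneg 0≤1) ,
    bd-cong (sym s₀) (sym e₀) (bd-weaken bd-0 0≤1)
  trig-dominated t@(isTrig c₀ s₀ p q) ∣x∣≤z e@(isExp e₀ r) (suc k) =
    let (∣c∣≤E , ∣s∣≤E) = trig-dominated t ∣x∣≤z e k in
    bd-cancel (0<1+n ℝ k) (bd-cong (sym (p k)) (sym (r k)) (bd-* (bd-neg ∣x∣≤z) ∣s∣≤E)) ,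
    bd-cancel (0<1+n ℝ k) (bd-cong (sym (q k)) (sym (r k)) (bd-* ∣x∣≤z ∣c∣≤E))

  -- The series of cosine and sine

  1/!-step : ∀ k → suc k · 1# * 1/_! ℝ (suc k) ≈ 1/_! ℝ k
  1/!-step k = begin
    m * g                ≈⟨ *-identityˡ _ ⟨
    1# * (m * g)         ≈⟨ *-congʳ f*n≈1 ⟨
    f * n * (m * g)      ≈⟨ solve 4 (λ f n m g → f :* n :* (m :* g) := f :* (g :* (m :* n))) refl f n m g ⟩
    f * (g * (m * n))    ≈⟨ *-congˡ (*-congˡ (·-homo-* (suc k) (k !))) ⟨
    f * (g * ((suc k !) · 1#)) ≈⟨ *-congˡ (inv (suc k)) ⟩
    f * 1#               ≈⟨ *-identityʳ f ⟩
    f                    ∎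
    where
    inv : ∀ k → 1/_! ℝ k * ((k !) · 1#) ≈ 1#
    inv k = trans (ℚ⇒ℝ-/ (+ 1) (k !) {{k ℕ.!≢0}}) (+-identityʳ 1#)
    f g m n : Carrier
    f = 1/_! ℝ k
    g = 1/_! ℝ (suc k)
    m = suc k · 1#
    n = (k !) · 1#
    f*n≈1 : f * n ≈ 1#
    f*n≈1 = inv k

  expSeq : Carrier → Seq
  expSeq x k = x ^ k * 1/_! ℝ k

  isExp-expSeq : ∀ x → IsExp x (expSeq x)
  isExp-expSeq x = isExp
    (trans (*-identityˡ _) (trans (sym (trans (*-congˡ (+-identityʳ 1#)) (*-identityʳ _)))
        (trans (ℚ⇒ℝ-/ (+ 1) 1) (+-identityʳ 1#))))
    (λ k → trans (solve 4 (λ m x p f → m :* (x :* p :* f) := x :* (p :* (m :* f))) refl _ _ _ _)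
                 (*-congˡ (*-congˡ (1/!-step k))))

  mutual
    -- `cosCoeff k` and `sinCoeff k` are the real and imaginary part of the k-th power of the
    -- imaginary unit.
    cosCoeff : Seq
    cosCoeff zero    = 1#
    cosCoeff (suc k) = - sinCoeff k

    sinCoeff : Seq
    sinCoeff zero    = 0#
    sinCoeff (suc k) = cosCoeff k

  cosSeq sinSeq : Carrier → Seq
  cosSeq x k = cosCoeff k * expSeq x k
  sinSeq x k = sinCoeff k * expSeq x k

  isTrig-cosSeq-sinSeq : ∀ x → IsTrig x (cosSeq x) (sinSeq x)
  isTrig-cosSeq-sinSeq x = isTrig
    (trans (*-identityˡ _) init)
    (zeroˡ _)
    (λ k → trans (solve 3 (λ m s e → m :* (:- s :* e) := :- s :* (m :* e)) refl _ _ _)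
      (trans (*-congˡ (step k)) (solve 3 (λ s x e → :- s :* (x :* e) := :- x :* (s :* e)) refl _ _ _)))
    (λ k → trans (solve 3 (λ m s e → m :* (s :* e) := s :* (m :* e)) refl _ _ _)
      (trans (*-congˡ (step k)) (solve 3 (λ s x e → s :* (x :* e) := x :* (s :* e)) refl _ _ _)))
    where open IsExp (isExp-expSeq x)

  dbl : ℕ → ℕ
  dbl zero    = zero
  dbl (suc n) = suc (suc (dbl n))

  dbl≡2* : ∀ n → dbl n ≡.≡ 2 ℕ.* n
  dbl≡2* zero    = ≡.refl
  dbl≡2* (suc n) = ≡.trans (≡.cong (λ m → suc (suc m)) (dbl≡2* n))
      (≡.cong suc (≡.sym (ℕ.+-suc n (n ℕ.+ 0))))

  n≤dbl : ∀ n → n ℕ.≤ dbl n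
  n≤dbl zero    = z≤n
  n≤dbl (suc n) = s≤s (ℕ.m≤n⇒m≤1+n (n≤dbl n))

  Σ-dbl : ∀ n a → Σ (dbl n) a ≈ Σ n (λ k → a (dbl k) + a (suc (dbl k)))
  Σ-dbl zero    a = refl
  Σ-dbl (suc n) a = trans (sym (+-assoc _ _ _)) (+-congˡ (Σ-dbl n (shift (shift a))))

  sum≡Σ : ∀ n t → sum {n} (λ k → t (toℕ k)) ≡.≡ Σ n t
  sum≡Σ zero    t = ≡.refl
  sum≡Σ (suc n) t = ≡.cong (λ s → t 0 + s) (sum≡Σ n (shift t))

  coeff-dbl : ∀ k → cosCoeff (dbl k) ≈ (- 1#) ^ k × sinCoeff (dbl k) ≈ 0#
  coeff-dbl zero    = refl , refl
  coeff-dbl (suc k) = let (p , q) = coeff-dbl k in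
    trans (-‿cong p) (solve 1 (λ x → :- x := :- :1 :* x) refl _) ,
    trans (-‿cong q) (solve 0 (:- :0 := :0) refl)

  -- Of the exponents 2k and 2k + 1 the cosine series has only the first and the sine series only
  -- the second. Hence n terms of either given series amount to 2n terms of `cosSeq` or `sinSeq`,
  -- which is why `CosSin` sums `dbl n` terms.
  cosTerm≈ : ∀ x k → cosTerm ℝ x k ≈ cosSeq x (dbl k) + cosSeq x (suc (dbl k))
  cosTerm≈ x k = let (p , q) = coeff-dbl k in sym (begin
    cosCoeff (dbl k) * expSeq x (dbl k) + - sinCoeff (dbl k) * expSeq x (suc (dbl k))
      ≈⟨ +-cong (*-congʳ p) (*-congʳ (-‿cong q)) ⟩
    (- 1#) ^ k * expSeq x (dbl k) + - 0# * expSeq x (suc (dbl k))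
      ≈⟨ solve 2 (λ x y → x :+ :- :0 :* y := x) refl _ _ ⟩
    (- 1#) ^ k * expSeq x (dbl k)
      ≡⟨ ≡.cong (λ m → (- 1#) ^ k * expSeq x m) (dbl≡2* k) ⟩
    cosTerm ℝ x k ∎)

  sinTerm≈ : ∀ x k → sinTerm ℝ x k ≈ sinSeq x (dbl k) + sinSeq x (suc (dbl k))
  sinTerm≈ x k = let (p , q) = coeff-dbl k in sym (begin
    sinCoeff (dbl k) * expSeq x (dbl k) + cosCoeff (dbl k) * expSeq x (suc (dbl k))
      ≈⟨ +-cong (*-congʳ q) (*-congʳ p) ⟩
    0# * expSeq x (dbl k) + (- 1#) ^ k * expSeq x (suc (dbl k))
      ≈⟨ solve 2 (λ x y → :0 :* x :+ y := y) refl _ _ ⟩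
    (- 1#) ^ k * expSeq x (suc (dbl k))
      ≡⟨ ≡.cong (λ m → (- 1#) ^ k * expSeq x (suc m)) (dbl≡2* k) ⟩
    sinTerm ℝ x k ∎)

  record CosSin (x p q : Carrier) : Set (c ⊔ ℓ₂) where
    constructor cosSin
    field
      cos⇝ : (λ n → Σ (dbl n) (cosSeq x)) ⇝ p
      sin⇝ : (λ n → Σ (dbl n) (sinSeq x)) ⇝ q

  isCosSin⇒CosSin : ∀ {x p q} → IsCosSin ℝ x (p , q) → CosSin x p q
  isCosSin⇒CosSin {x} (C , S) = cosSin
    (⇝-cong (λ n → trans (reflexive (sum≡Σ n _)) (trans (Σ-cong n (cosTerm≈ x)) (sym (Σ-dbl n _)))) (⟶⇒⇝ C))
    (⇝-cong (λ n → trans (reflexive (sum≡Σ n _)) (trans (Σ-cong n (sinTerm≈ x)) (sym (Σ-dbl n _)))) (⟶⇒⇝ S))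

  fromTrig : ∀ {x c s p q} → IsTrig x c s → (λ n → Σ (dbl n) c) ⇝ p → (λ n → Σ (dbl n) s) ⇝ q → CosSin x p q
  fromTrig {x} t c⇝ s⇝ = cosSin
    (⇝-cong (λ n → Σ-cong (dbl n) λ k → proj₁ (same k)) c⇝)
    (⇝-cong (λ n → Σ-cong (dbl n) λ k → proj₂ (same k)) s⇝)
    where same = trig-unique t (isTrig-cosSeq-sinSeq x)

  CosSin-unique : ∀ {x p q p′ q′} → CosSin x p q → CosSin x p′ q′ → p ≈ p′ × q ≈ q′
  CosSin-unique (cosSin C S) (cosSin C′ S′) = ⇝-unique C C′ , ⇝-unique S S′

  CosSin-cong : ∀ {x y p q} → x ≈ y → CosSin x p q → CosSin y p q
  CosSin-cong {x} x≈y (cosSin C S) = fromTrig (trig-cong x≈y (isTrig-cosSeq-sinSeq x)) C S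

  CosSin-neg : ∀ {x p q} → CosSin x p q → CosSin (- x) p (- q)
  CosSin-neg {x} (cosSin C S) = fromTrig (trig-neg (isTrig-cosSeq-sinSeq x)) C
    (⇝-cong (λ n → sym (Σ-neg (dbl n) _)) (⇝-neg S))

  CosSin-0 : CosSin 0# 1# 0#
  CosSin-0 = fromTrig {c = one} {s = λ _ → 0#}
    (isTrig refl refl (λ k → trans (zeroʳ _) (sym (zeroʳ _))) (λ k → trans (zeroʳ _) (sym (zeroˡ _))))
    -- The threshold is 1 because the empty sum is 0 and not yet the limit 1.
    (λ k → 1 , λ { (suc n) _ → bd-cong
        (sym (trans (*-congˡ (trans (+-congʳ (trans (+-congˡ (Σ-0 (suc (dbl n)))) (+-identityʳ 1#)))
        (-‿inverseʳ 1#))) (zeroʳ _))) refl (bd-weaken bd-0 0≤1) })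
    (λ k → 0 , λ n _ → bd-cong (sym
        (trans (*-congˡ (trans (+-congʳ (Σ-0 (dbl n))) (-‿inverseʳ 0#))) (zeroʳ _))) refl
        (bd-weaken bd-0 0≤1))
    where
    one : Seq
    one zero    = 1#
    one (suc k) = 0#
    Σ-0 : ∀ n → Σ n (λ _ → 0#) ≈ 0#
    Σ-0 zero    = refl
    Σ-0 (suc n) = trans (+-identityˡ _) (Σ-0 n)

  -- The addition theorem

  ·-mono-≤ : ∀ {m n} → m ℕ.≤ n → m · 1# ≤ n · 1#
  ·-mono-≤ {n = n} z≤n = 0≤n n
  ·-mono-≤ (s≤s m≤n)   = +-mono-≤ (≤-reflexive refl) (·-mono-≤ m≤n)

  module ExpTail (m : ℕ) {E : Seq} (isE : IsExp (m · 1#) E) where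
    open IsExp isE

    two : Carrier
    two = 1# + 1#

    E≥0 : NonNegative E
    E≥0 = exp-nonneg (0≤n m) isE

    -- The ratio of successive terms is m / (k + 1), at most 1 / 2 from k = 2m on.
    halving : ∀ {k} → m ℕ.+ m ℕ.≤ k → two * E (suc k) ≤ E k
    halving {k} 2m≤k = 0≤-⇒≤ (cancel-0≤ (0<1+n ℝ k) (≤-respʳ
      (begin
        (suc k · 1# - (M + M)) * E k
          ≈⟨ solve 3 (λ n m e → (n :- (m :+ m)) :* e := n :* e :- (:1 :+ :1) :* (m :* e)) refl _ _ _ ⟩
        suc k · 1# * E k - two * (M * E k)
          ≈⟨ +-congˡ (-‿cong (*-congˡ (step k))) ⟨
        suc k · 1# * E k - two * (suc k · 1# * E (suc k))
          ≈⟨ solve 4 (λ n t e f → n :* e :- t :* (n :* f) := n :* (e :- t :* f)) refl _ two _ _ ⟩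
        suc k · 1# * (E k - two * E (suc k)) ∎)
      (0≤x*y (≤⇒0≤- (≤-respˡ (·-homo-+ m m) (·-mono-≤ (ℕ.m≤n⇒m≤1+n 2m≤k)))) (E≥0 k))))
      where
      M : Carrier
      M = m · 1#

    -- The summand `two * E (d ℕ.+ n)` on the left bounds everything still to come; with it the
    -- inductive step is a single use of `halving`.
    tail : ∀ d {n} → m ℕ.+ m ℕ.≤ n → Σ (d ℕ.+ n) E - Σ n E + two * E (d ℕ.+ n) ≤ two * E n
    tail zero    2m≤n = ≤-reflexive (solve 2 (λ s e → s :- s :+ e := e) refl _ _)
    tail (suc d) {n} 2m≤n = ≤-trans
      (≤-respˡ (+-congʳ (+-congʳ (sym (Σ-last (d ℕ.+ n) E))))
        (≤-cert (≤⇒0≤- (halving {d ℕ.+ n} (ℕ.≤-trans 2m≤n (ℕ.m≤n+m n d))))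
          (solve 4 (λ s e f t → (s :- t :+ (:1 :+ :1) :* e) :- (s :+ e :- t :+ (:1 :+ :1) :* f)
              := e :- (:1 :+ :1) :* f) refl
            (Σ (d ℕ.+ n) E) (E (d ℕ.+ n)) (E (suc d ℕ.+ n)) (Σ n E))))
      (tail d 2m≤n)

    -- The halving would give a geometric rate; the weaker 1 / (j + 1) is easier to compare with a
    -- natural number and tends to 0 as well.
    decay : ∀ j → suc j · 1# * E (j ℕ.+ (m ℕ.+ m)) ≤ E (m ℕ.+ m)
    decay zero    = ≤-reflexive (solve 1 (λ e → (:1 :+ :0) :* e := e) refl _)
    decay (suc j) = ≤-trans
      (≤-cert (0≤x+y (0≤x*y (0≤n j) (E≥0 (suc j ℕ.+ (m ℕ.+ m))))
          (0≤x*y (0≤n (suc j)) (≤⇒0≤- (halving {j ℕ.+ (m ℕ.+ m)} (ℕ.m≤n+m (m ℕ.+ m) j)))))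
        (solve 3 (λ j e f → (:1 :+ j) :* e :- (:1 :+ (:1 :+ j)) :* f
            := j :* f :+ (:1 :+ j) :* (e :- (:1 :+ :1) :* f)) refl
          (j · 1#) (E (j ℕ.+ (m ℕ.+ m))) (E (suc j ℕ.+ (m ℕ.+ m)))))
      (decay j)

    null : Null (λ n → Σ (n ℕ.+ n) E - Σ n E)
    null k = N , bound
      where
      B : ℕ
      B = proj₁ (archimedean (E (m ℕ.+ m)))
      -- As B > E (2m), `decay` gives (B + 1) 2k E (j + 2m) ≤ E (2m) < B + 1 for j ≥ J; the factor B
      -- + 1 rather than B is certain to be positive and can be cancelled. The factor 2 in 2k pays
      -- for the one in `tail`.
      J N : ℕ
      J = suc B ℕ.* (k ℕ.+ k)
      N = J ℕ.+ (m ℕ.+ m)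
      small : ∀ j → J ℕ.≤ j → k · 1# * (two * E (j ℕ.+ (m ℕ.+ m))) ≤ 1#
      small j J≤j = 0≤-⇒≤ (cancel-0≤ (0<1+n ℝ B) (≤-respʳ
        (solve 3 (λ b k e → b :- (b :* (k :+ k)) :* e := b :* (:1 :- k :* ((:1 :+ :1) :* e))) refl _ _ _)
        (≤⇒0≤- (≤-trans
          (≤-respˡ (*-congʳ (trans (·-homo-* (suc B) (k ℕ.+ k)) (*-congˡ (·-homo-+ k k))))
            (≤-cert (0≤x*y (≤⇒0≤- (·-mono-≤ (ℕ.m≤n⇒m≤1+n J≤j))) (E≥0 (j ℕ.+ (m ℕ.+ m))))
              (solve 3 (λ x y e → y :* e :- x :* e := (y :- x) :* e) refl _ _ _)))
          (≤-trans (decay j) (≤-trans (<⇒≤ (proj₂ (archimedean (E (m ℕ.+ m)))))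
            (·-mono-≤ (ℕ.n≤1+n B))))))))
      bound : ∀ n → N ℕ.≤ n → ∣ k · 1# * (Σ (n ℕ.+ n) E - Σ n E) ∣≤ 1#
      bound n N≤n = bd-weaken
        (bd-* (bd-nonneg (0≤n k)) (bd-nonneg (Σ-mono E≥0 (ℕ.m≤n+m n n))))
        (≤-trans (*-monoˡ-≤ (0≤n k) (≤-trans
            (≤-cert (0≤x*y (<⇒≤ 0<2) (E≥0 (n ℕ.+ n))) (solve 2 (λ x y → (x :+ y) :- x := y) refl _ _))
            (tail n (ℕ.≤-trans (ℕ.m≤n+m (m ℕ.+ m) J) N≤n))))
          (≡.subst (λ i → k · 1# * (two * E i) ≤ 1#) (ℕ.m∸n+n≡m (ℕ.≤-trans (ℕ.m≤n+m (m ℕ.+ m) J) N≤n))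
            (small (n ℕ.∸ (m ℕ.+ m)) (ℕ.≤-trans (ℕ.≤-reflexive (≡.sym (ℕ.m+n∸n≡m J (m ℕ.+ m))))
                (ℕ.∸-monoˡ-≤ (m ℕ.+ m) N≤n)))))

  Null-dbl : ∀ {u} → Null u → Null (λ n → u (dbl n))
  Null-dbl nu k = let (N , f) = nu k in N , λ n N≤n → f (dbl n) (ℕ.≤-trans N≤n (n≤dbl n))

  -- `conv E E` is the exponential series of 2z, so its sums over the blocks from n to 2n tend to 0,
  -- and by `product-remainder` these dominate the error of the Cauchy product.
  conv⇝ : ∀ z {a b p q} → Dominated a (expSeq (z · 1#)) → Dominated b (expSeq (z · 1#)) →
    (λ n → Σ (dbl n) a) ⇝ p → (λ n → Σ (dbl n) b) ⇝ q → (λ n → Σ (dbl n) (conv a b)) ⇝ (p * q)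
  conv⇝ z {a} {b} domA domB a⇝p b⇝q = ⇝-near (Null-dbl near) (⇝-* a⇝p b⇝q)
    where
    E : Seq
    E = expSeq (z · 1#)
    E≥0 : NonNegative E
    E≥0 = exp-nonneg (0≤n z) (isExp-expSeq _)
    open ExpTail (z ℕ.+ z) {conv E E}
      (exp-cong (sym (·-homo-+ z z)) (exp-conv (isExp-expSeq _) (isExp-expSeq _)))
      using (null)
    near : Null (λ n → Σ n a * Σ n b - Σ n (conv a b))
    near k = let (N , f) = null k in N , λ n N≤n →
      bd-weaken
        (bd-* (bd-nonneg (0≤n k)) (product-remainder n domA domB E≥0 E≥0))
        (0≤-⇒≤ (proj₁ (f n N≤n)))

  CosSin-+ : ∀ {x y p q p′ q′} → CosSin x p q → CosSin y p′ q′ →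
    CosSin (x + y) (p * p′ - q * q′) (q * p′ + p * q′)
  CosSin-+ {x} {y} (cosSin C S) (cosSin C′ S′) =
    fromTrig (trig-conv tx ty)
      (⇝-cong (λ n → trans (+-congˡ (sym (Σ-neg (dbl n) _))) (sym (Σ-+ (dbl n) _ _)))
        (⇝-+ (conv⇝ z cx cy C C′) (⇝-neg (conv⇝ z sx sy S S′))))
      (⇝-cong (λ n → sym (Σ-+ (dbl n) _ _))
        (⇝-+ (conv⇝ z sx cy S C′) (conv⇝ z cx sy C S′)))
    where
    b₁ b₂ z : ℕ
    b₁ = proj₁ (bounded x)
    b₂ = proj₁ (bounded y)
    -- A common bound of ∣ x ∣ and ∣ y ∣ lets one exponential series dominate all four factors.
    z  = suc b₁ ℕ.+ suc b₂
    tx = isTrig-cosSeq-sinSeq x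
    ty = isTrig-cosSeq-sinSeq y
    dx = trig-dominated tx (bd-weaken (proj₂ (bounded x)) (·-mono-≤ (ℕ.m≤m+n (suc b₁) (suc b₂))))
        (isExp-expSeq (z · 1#))
    dy = trig-dominated ty (bd-weaken (proj₂ (bounded y)) (·-mono-≤ (ℕ.m≤n+m (suc b₂) (suc b₁))))
        (isExp-expSeq (z · 1#))
    cx : Dominated (cosSeq x) (expSeq (z · 1#))
    cx k = proj₁ (dx k)
    sx : Dominated (sinSeq x) (expSeq (z · 1#))
    sx k = proj₂ (dx k)
    cy : Dominated (cosSeq y) (expSeq (z · 1#))
    cy k = proj₁ (dy k)
    sy : Dominated (sinSeq y) (expSeq (z · 1#))
    sy k = proj₂ (dy k)

  -- This is the addition theorem for x and - x, compared with the values at 0.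
  cos²+sin²≈1 : ∀ {x p q} → CosSin x p q → p * p + q * q ≈ 1#
  cos²+sin²≈1 {x} {p} {q} cs = begin
    p * p + q * q        ≈⟨ solve 2 (λ p q → p :* p :+ q :* q := p :* p :- q :* :- q) refl p q ⟩
    p * p - q * - q      ≈⟨ proj₁ (CosSin-unique
        (CosSin-cong (-‿inverseʳ x) (CosSin-+ cs (CosSin-neg cs))) CosSin-0) ⟩
    1#                   ∎

  -- Expanding gives p³ - 3 p q² = 4 p³ - 3 p (p² + q²), where the last bracket is 1.
  cos-triple : ∀ {x p q p₃ q₃} → CosSin x p q → CosSin (x + x + x) p₃ q₃ →
    p₃ ≈ p * p * p + (p * p * p + (p * p * p + p * p * p)) - (p + (p + p))
  cos-triple {x} {p} {q} {p₃} cs cs₃ = begin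
    p₃
      ≈⟨ proj₁ (CosSin-unique cs₃ (CosSin-+ (CosSin-+ cs cs) cs)) ⟩
    (p * p - q * q) * p - (q * p + p * q) * q
      ≈⟨ solve 2 (λ p q → (p :* p :- q :* q) :* p :- (q :* p :+ p :* q) :* q :=
                   p :* p :* p :+ (p :* p :* p :+ (p :* p :* p :+ p :* p :* p)) :-
                       (p :+ (p :+ p)) :* (p :* p :+ q :* q)) refl p q ⟩
    p * p * p + (p * p * p + (p * p * p + p * p * p)) - (p + (p + p)) * (p * p + q * q)
      ≈⟨ +-congˡ (-‿cong (trans (*-congˡ (cos²+sin²≈1 cs)) (*-identityʳ _))) ⟩
    p * p * p + (p * p * p + (p * p * p + p * p * p)) - (p + (p + p)) ∎

  -- Quadratic extensions

  infixl 6 _⊕_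
  _⊕_ : ∀ {x y} → x ≈ 0# → y ≈ 0# → x + y ≈ 0#
  p ⊕ q = trans (+-cong p q) (+-identityˡ 0#)

  infixr 7 _⊛_
  _⊛_ : ∀ x {y} → y ≈ 0# → x * y ≈ 0#
  x ⊛ p = trans (*-congˡ p) (zeroʳ x)

  diff : ∀ {x y} → x ≈ y → x - y ≈ 0#
  diff x≈y = trans (+-congʳ x≈y) (-‿inverseʳ _)

  -- Equations are derived from others by exhibiting x - y as a combination z of vanishing terms,
  -- assembled with `_⊕_`, `_⊛_` and `diff`; the ring solver checks the cofactors.
  ≈-cert : ∀ {x y z} → z ≈ 0# → x - y ≈ z → x ≈ y
  ≈-cert {x} {y} {z} z≈0 eq = trans (solve 2 (λ x y → x := (x :- y) :+ y) refl x y)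
    (trans (+-congʳ (trans eq z≈0)) (+-identityˡ y))

  Root : Carrier → Carrier → Set ℓ₁
  Root a x = x * x * x ≈ (x + (x + x)) + a

  -- Subfields of ℝ, as ¬¬-stable predicates, without a root of x³ - 3x - a.
  record RootFree (a : Carrier) : Set (lsuc (c ⊔ ℓ₁)) where
    field
      _∈F    : Pred Carrier (c ⊔ ℓ₁)
      stable : ∀ {x} → ¬ ¬ (x ∈F) → x ∈F
      resp   : ∀ {x y} → x ≈ y → x ∈F → y ∈F
      a∈     : a ∈F
      1∈     : 1# ∈F
      +∈     : ∀ {x y} → x ∈F → y ∈F → (x + y) ∈F
      *∈     : ∀ {x y} → x ∈F → y ∈F → (x * y) ∈F
      -∈     : ∀ {x} → x ∈F → (- x) ∈F
      inv∈   : ∀ {x y} → x ∈F → x * y ≈ 1# → y ∈F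
      noRoot : ∀ {x} → x ∈F → ¬ Root a x

    sub∈ : ∀ {x y} → x ∈F → y ∈F → (x - y) ∈F
    sub∈ x∈ y∈ = +∈ x∈ (-∈ y∈)

    0∈ : 0# ∈F
    0∈ = resp (-‿inverseʳ 1#) (sub∈ 1∈ 1∈)

  open RootFree using (_∈F)

  infix 4 _∈_ _⊆_
  _∈_ : ∀ {a} → Carrier → RootFree a → Set (c ⊔ ℓ₁)
  x ∈ F = (F ∈F) x

  _⊆_ : ∀ {a} → RootFree a → RootFree a → Set (c ⊔ ℓ₁)
  F ⊆ G = ∀ {x} → x ∈ F → x ∈ G

  module Adjoin {a : Carrier} (F : RootFree a) (w : Carrier) (w²∈ : w * w ∈ F) (w∉ : ¬ (w ∈ F)) where
    open RootFree F hiding (_∈F)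

    InSpan : Carrier → Set (c ⊔ ℓ₁)
    InSpan x = ∃[ u ] ∃[ v ] u ∈ F × v ∈ F × x ≈ u + v * w

    -- If v were nonzero, w = - u / v would lie in F.
    independent : ∀ {u v} → u ∈ F → v ∈ F → u + v * w ≈ 0# → u ≈ 0# × v ≈ 0#
    independent {u} {v} u∈ v∈ u+vw≈0 = u≈0 , v≈0
      where
      v≈0 : v ≈ 0#
      v≈0 = ≈-stable λ v≉0 → inverse v≉0 λ (z , vz≈1) → w∉
        (resp (≈-cert ((- z) ⊛ diff u+vw≈0 ⊕ w ⊛ diff vz≈1)
                (solve 4 (λ u v w z → :- u :* z :- w
                    := :- z :* ((u :+ v :* w) :- :0) :+ w :* (v :* z :- :1)) refl u v w z))
              (*∈ (-∈ u∈) (inv∈ v∈ vz≈1)))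
      u≈0 : u ≈ 0#
      u≈0 = ≈-cert (diff u+vw≈0 ⊕ (- w) ⊛ v≈0)
        (solve 3 (λ u v w → u :- :0 := (u :+ v :* w :- :0) :+ :- w :* v) refl u v w)

    extension : RootFree a
    extension = record
      { _∈F    = λ x → ¬ ¬ InSpan x
      ; stable = λ ¬¬x k → ¬¬x λ x → x k
      ; resp   = λ x≈y x∈ k → x∈ λ (u , v , u∈ , v∈ , eq) → k (u , v , u∈ , v∈ , trans (sym x≈y) eq)
      ; a∈     = λ k → k (a , 0# , a∈ , 0∈ , solve 2 (λ a w → a := a :+ :0 :* w) refl a w)
      ; 1∈     = λ k → k (1# , 0# , 1∈ , 0∈ , solve 1 (λ w → :1 := :1 :+ :0 :* w) refl w)
      ; +∈     = λ x∈ y∈ k → x∈ λ (u , v , u∈ , v∈ , p) → y∈ λ (u′ , v′ , u′∈ , v′∈ , q) →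
          k (u + u′ , v + v′ , +∈ u∈ u′∈ , +∈ v∈ v′∈ , trans (+-cong p q)
            (solve 5 (λ u v u′ v′ w → (u :+ v :* w) :+ (u′ :+ v′ :* w)
                := (u :+ u′) :+ (v :+ v′) :* w) refl u v u′ v′ w))
      ; *∈     = λ x∈ y∈ k → x∈ λ (u , v , u∈ , v∈ , p) → y∈ λ (u′ , v′ , u′∈ , v′∈ , q) →
          k (u * u′ + v * v′ * (w * w) , u * v′ + v * u′ ,
             +∈ (*∈ u∈ u′∈) (*∈ (*∈ v∈ v′∈) w²∈) , +∈ (*∈ u∈ v′∈) (*∈ v∈ u′∈) , trans (*-cong p q)
            (solve 5 (λ u v u′ v′ w → (u :+ v :* w) :* (u′ :+ v′ :* w) :=
               (u :* u′ :+ v :* v′ :* (w :* w)) :+ (u :* v′ :+ v :* u′) :* w) refl u v u′ v′ w))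
      ; -∈     = λ x∈ k → x∈ λ (u , v , u∈ , v∈ , p) →
          k (- u , - v , -∈ u∈ , -∈ v∈ , trans (-‿cong p)
            (solve 3 (λ u v w → :- (u :+ v :* w) := :- u :+ :- v :* w) refl u v w))
      ; inv∈   = λ x∈ xy≈1 k → x∈ λ x∈′ → invert x∈′ xy≈1 k
      ; noRoot = λ x∈ root → x∈ λ x∈′ → no-root x∈′ root
      }
      where
      -- The inverse of u + v w is its conjugate divided by the norm N. If N were 0, the conjugate
      -- would vanish because x does not; then u = v = 0 by independence, and x = 0 after all.
      invert : ∀ {x y} → InSpan x → x * y ≈ 1# → ¬ ¬ InSpan y
      invert {x} {y} (u , v , u∈ , v∈ , x≈) xy≈1 k = inverse N≉0 λ (z , Nz≈1) →
        k (u * z , - v * z , *∈ u∈ (inv∈ N∈ Nz≈1) , *∈ (-∈ v∈) (inv∈ N∈ Nz≈1) ,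
          ≈-cert ((- y) ⊛ diff Nz≈1 ⊕ ((u - v * w) * z) ⊛ diff xy≈1 ⊕ (- y * ((u - v * w) * z)) ⊛ diff x≈)
            (solve 6 (λ x y u v w z → y :- (u :* z :+ :- v :* z :* w) :=
                :- y :* ((u :* u :- v :* v :* (w :* w)) :* z :- :1) :+ ((u :- v :* w) :* z) :*
                    (x :* y :- :1)
                  :+ :- y :* ((u :- v :* w) :* z) :* (x :- (u :+ v :* w))) refl x y u v w z))
        where
        N : Carrier
        N = u * u - v * v * (w * w)
        N∈ : N ∈ F
        N∈ = sub∈ (*∈ u∈ u∈) (*∈ (*∈ v∈ v∈) w²∈)
        x≉0 : ¬ (x ≈ 0#)
        x≉0 x≈0 = 1≉0 (trans (sym xy≈1) (trans (*-congʳ x≈0) (zeroˡ y)))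
        N≉0 : ¬ (N ≈ 0#)
        N≉0 N≈0 =
          let u-vw≈0 = integral {x} {u + - v * w}
                (trans (*-congʳ x≈) (trans (solve 3
                    (λ u v w → (u :+ v :* w) :* (u :+ :- v :* w)
                    := u :* u :- v :* v :* (w :* w)) refl u v w) N≈0)) x≉0
              (u≈0 , -v≈0) = independent u∈ (-∈ v∈) u-vw≈0
          in x≉0 (≈-cert (diff x≈ ⊕ u≈0 ⊕ (- w) ⊛ -v≈0)
               (solve 4 (λ x u v w → x :- :0 := (x :- (u :+ v :* w)) :+ u :+ :- w :* :- v) refl x u v w))

      -- If u + vw is a root with v ≠ 0 then so is its conjugate u - vw, and
      -- the roots sum to 0.
      no-root : ∀ {x} → InSpan x → ¬ Root a x
      no-root {x} (u , v , u∈ , v∈ , x≈) root =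
        noRoot (-∈ (+∈ u∈ u∈)) (≈-cert (A≈0 ⊕ (- (u + (u + u))) ⊛ C≈0)
          (solve 4 (λ u v w a →
             (:- (u :+ u) :* :- (u :+ u) :* :- (u :+ u)) :-
                 ((:- (u :+ u) :+ (:- (u :+ u) :+ :- (u :+ u))) :+ a)
             := (u :* u :* u :+ (u :+ (u :+ u)) :* (v :* v :* (w :* w)) :- (u :+ (u :+ u)) :- a)
                :+ :- (u :+ (u :+ u)) :* (u :* u :+ (u :* u :+ u :* u) :+ v :* v :* (w :* w) :-
                    (:1 :+ (:1 :+ :1)))) refl u v w a))
        where
        -- A + v C w is the expansion of (u + v w)³ - 3 (u + v w) - a, so A = 0 and v C = 0. If v =
        -- 0, then A = 0 makes u a root in F; otherwise C = 0, and A - 3 u C is the value of the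
        -- cubic at - 2 u.
        A C : Carrier
        A = u * u * u + (u + (u + u)) * (v * v * (w * w)) - (u + (u + u)) - a
        C = u * u + (u * u + u * u) + v * v * (w * w) - (1# + (1# + 1#))
        root′ : Root a (u + v * w)
        root′ = trans (*-cong (*-cong (sym x≈) (sym x≈)) (sym x≈))
            (trans root (+-congʳ (+-cong x≈ (+-cong x≈ x≈))))
        3u∈ : u + (u + u) ∈ F
        3u∈ = +∈ u∈ (+∈ u∈ u∈)
        v²w²∈ : v * v * (w * w) ∈ F
        v²w²∈ = *∈ (*∈ v∈ v∈) w²∈
        components : A ≈ 0# × v * C ≈ 0#
        components = independent
          (sub∈ (sub∈ (+∈ (*∈ (*∈ u∈ u∈) u∈) (*∈ 3u∈ v²w²∈)) 3u∈) a∈)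
          (*∈ v∈ (sub∈ (+∈ (+∈ (*∈ u∈ u∈) (+∈ (*∈ u∈ u∈) (*∈ u∈ u∈))) v²w²∈) (+∈ 1∈ (+∈ 1∈ 1∈))))
          (trans (solve 4 (λ u v w a →
             (u :* u :* u :+ (u :+ (u :+ u)) :* (v :* v :* (w :* w)) :- (u :+ (u :+ u)) :- a)
               :+ v :* (u :* u :+ (u :* u :+ u :* u) :+ v :* v :* (w :* w) :- (:1 :+ (:1 :+ :1))) :* w
             := (u :+ v :* w) :* (u :+ v :* w) :* (u :+ v :* w)
               :- (((u :+ v :* w) :+ ((u :+ v :* w) :+ (u :+ v :* w))) :+ a)) refl u v w a)
            (diff root′))
        A≈0 : A ≈ 0#
        A≈0 = proj₁ components
        v≉0 : ¬ (v ≈ 0#)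
        v≉0 v≈0 = noRoot u∈ (≈-cert (A≈0 ⊕ (- ((u + (u + u)) * (v * (w * w)))) ⊛ v≈0)
          (solve 4 (λ u v w a → u :* u :* u :- ((u :+ (u :+ u)) :+ a) :=
             (u :* u :* u :+ (u :+ (u :+ u)) :* (v :* v :* (w :* w)) :- (u :+ (u :+ u)) :- a)
               :+ :- ((u :+ (u :+ u)) :* (v :* (w :* w))) :* v) refl u v w a))
        C≈0 : C ≈ 0#
        C≈0 = integral (proj₂ components) v≉0

  module _ {a : Carrier} where

    -- Whether w lies in F cannot be decided. The continuation is first given F itself, with w ∈ F
    -- proved by stability; should w ∉ F be assumed there, the same continuation receives the proper
    -- extension.
    adjoin : (F : RootFree a) → ∀ {w} → w * w ∈ F → ¬ ¬ (∃[ G ] F ⊆ G × w ∈ G)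
    adjoin F {w} w²∈ k = k (F , (λ x∈ → x∈) , stable F λ w∉ → let open Adjoin F w w²∈ w∉ in
        k (extension ,
           (λ {x} x∈ l → l (x , 0# , x∈ , 0∈ F , solve 2 (λ x w → x := x :+ :0 :* w) refl x w)) ,
           λ l → l (0# , 1# , 0∈ F , 1∈ F , solve 1 (λ w → w := :0 :+ :1 :* w) refl w)))
      where
      open RootFree using (stable; 0∈; 1∈)

    2≉0 : ¬ (1# + 1# ≈ 0#)
    2≉0 2≈0 = <.irrefl (sym 2≈0) (0<x+y 0<1 0<1)

    -- Completing the square.
    adjoin-quadratic : (F : RootFree a) → ∀ {w β γ} → β ∈ F → γ ∈ F → w * w ≈ β * w + γ →
      ¬ ¬ (∃[ G ] F ⊆ G × w ∈ G)
    adjoin-quadratic F {w} {β} {γ} β∈ γ∈ eq k = inverse 2≉0 λ (h , 2h≈1) →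
      adjoin F {(1# + 1#) * w - β}
        (resp (≈-cert ((- ((1# + 1#) * (1# + 1#))) ⊛ diff eq)
                 (solve 3 (λ w β γ → (β :* β :+ (:1 :+ :1) :* (:1 :+ :1) :* γ) :-
                     ((:1 :+ :1) :* w :- β) :* ((:1 :+ :1) :* w :- β)
                     := :- ((:1 :+ :1) :* (:1 :+ :1)) :* (w :* w :- (β :* w :+ γ))) refl w β γ))
              (+∈ (*∈ β∈ β∈) (*∈ (*∈ 2∈ 2∈) γ∈)))
        λ (G , F⊆G , W∈) → k (G , (λ {x} → F⊆G {x}) ,
          RootFree.resp G
            (≈-cert (w ⊛ diff 2h≈1) (solve 3
                (λ w β h → h :* (((:1 :+ :1) :* w :- β) :+ β) :- w
                := w :* ((:1 :+ :1) :* h :- :1)) refl w β h))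
            (RootFree.*∈ G (F⊆G (inv∈ 2∈ 2h≈1)) (RootFree.+∈ G W∈ (F⊆G β∈))))
      where
      open RootFree F using (resp; +∈; *∈; 1∈; inv∈)
      2∈ : 1# + 1# ∈ F
      2∈ = +∈ 1∈ 1∈

  -- Constructible points

  -- lin p q r is px + qy = r, circ e f g is x² + y² + ex + fy = g.
  data Equation : Set c where
    lin circ : Carrier → Carrier → Carrier → Equation

  Satisfies : Point ℝ → Equation → Set ℓ₁
  Satisfies (x , y) (lin p q r)  = p * x + q * y ≈ r
  Satisfies (x , y) (circ e f g) = x * x + y * y + (e * x + f * y) ≈ g

  equation : Curve ℝ → Equation
  equation (line (a , b) (a′ , b′)) = lin (b′ - b) (- (a′ - a)) (a * (b′ - b) - b * (a′ - a))
  equation (circle (o , o′) (u , v)) = circ (- (o + o)) (- (o′ + o′))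
    ((u - o) * (u - o) + (v - o′) * (v - o′) - (o * o + o′ * o′))

  transfer : ∀ {x y x′ y′} → x - y ≈ x′ - y′ → x ≈ y → x′ ≈ y′
  transfer eq x≈y = ≈-cert (diff x≈y) (sym eq)

  on⇔satisfies : ∀ P K → _on_ ℝ P K ⇔ Satisfies P (equation K)
  on⇔satisfies (x , y) (line (a , b) (a′ , b′)) = mk⇔ (transfer eq) (transfer (sym eq))
    where
    eq = solve 6 (λ x y a b a′ b′ → (x :- a) :* (b′ :- b) :- (y :- b) :* (a′ :- a) :=
           ((b′ :- b) :* x :+ :- (a′ :- a) :* y) :- (a :* (b′ :- b) :- b :* (a′ :- a))) refl x y a b a′ b′
  on⇔satisfies (x , y) (circle (o , o′) (u , v)) = mk⇔ (transfer eq) (transfer (sym eq))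
    where
    eq = solve 6 (λ x y o o′ u v →
           ((x :- o) :^ 2 :+ (y :- o′) :^ 2) :- ((u :- o) :^ 2 :+ (v :- o′) :^ 2) :=
           (x :* x :+ y :* y :+ (:- (o :+ o) :* x :+ :- (o′ :+ o′) :* y))
             :- ((u :- o) :* (u :- o) :+ (v :- o′) :* (v :- o′) :- (o :* o :+ o′ :* o′))) refl x y o o′ u v

  module Step {a : Carrier} (F : RootFree a) where
    open RootFree F hiding (_∈F)

    PointIn : Point ℝ → Set (c ⊔ ℓ₁)
    PointIn (x , y) = x ∈ F × y ∈ F

    ReachedBy : Point ℝ → Set (lsuc (c ⊔ ℓ₁))
    ReachedBy (x , y) = ∃[ G ] F ⊆ G × x ∈ G × y ∈ G

    Proper : Equation → Set (c ⊔ ℓ₁)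
    Proper (lin p q r)  = p ∈ F × q ∈ F × r ∈ F × ¬ (p ≈ 0# × q ≈ 0#)
    Proper (circ e f g) = e ∈ F × f ∈ F × g ∈ F

    -- w = qx - py satisfies a quadratic equation over F and parametrises
    -- the line.
    line-circle : ∀ {p q r e f g x y} → Proper (lin p q r) → Proper (circ e f g) →
      Satisfies (x , y) (lin p q r) → Satisfies (x , y) (circ e f g) → ¬ ¬ ReachedBy (x , y)
    line-circle {p} {q} {r} {e} {f} {g} {x} {y} (p∈ , q∈ , r∈ , pq≉0) (e∈ , f∈ , g∈) on-line on-circle k =
      inverse m≉0 λ (z , mz≈1) →
      adjoin-quadratic F β∈ γ∈ quadratic λ (G , F⊆G , w∈) →
        let open RootFree G using () renaming (resp to respG; +∈ to +∈G; *∈ to *∈G; -∈ to -∈G)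
            z∈ = F⊆G (inv∈ m∈ mz≈1)
        in k (G , (λ {x} → F⊆G {x}) ,
          respG (≈-cert (x ⊛ diff mz≈1 ⊕ (- (z * p)) ⊛ diff on-line)
                 (solve 6 (λ x y z p q r → z :* (p :* r :+ q :* (q :* x :- p :* y)) :- x :=
                    x :* ((p :* p :+ q :* q) :* z :- :1) :+ :- (z :* p) :*
                        ((p :* x :+ q :* y) :- r)) refl x y z p q r))
            (*∈G z∈ (+∈G (F⊆G (*∈ p∈ r∈)) (*∈G (F⊆G q∈) w∈))) ,
          respG (≈-cert (y ⊛ diff mz≈1 ⊕ (- (z * q)) ⊛ diff on-line)
                 (solve 6 (λ x y z p q r → z :* (q :* r :+ :- (p :* (q :* x :- p :* y))) :- y :=
                    y :* ((p :* p :+ q :* q) :* z :- :1) :+ :- (z :* q) :*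
                        ((p :* x :+ q :* y) :- r)) refl x y z p q r))
            (*∈G z∈ (+∈G (F⊆G (*∈ q∈ r∈)) (-∈G (*∈G (F⊆G p∈) w∈)))))
      where
      -- On the line m x = p r + q w, m y = q r - p w and m (x² + y²) = r² + w². Substituted into m
      -- times the circle equation, this is w² = β w + γ.
      m w β γ : Carrier
      m = p * p + q * q
      w = q * x - p * y
      β = p * f - q * e
      γ = m * g - r * r - r * (p * e + q * f)
      m∈ : m ∈ F
      m∈ = +∈ (*∈ p∈ p∈) (*∈ q∈ q∈)
      β∈ : β ∈ F
      β∈ = sub∈ (*∈ p∈ f∈) (*∈ q∈ e∈)
      γ∈ : γ ∈ F
      γ∈ = sub∈ (sub∈ (*∈ m∈ g∈) (*∈ r∈ r∈)) (*∈ r∈ (+∈ (*∈ p∈ e∈) (*∈ q∈ f∈)))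
      m≉0 : ¬ (m ≈ 0#)
      m≉0 m≈0 = pq≉0 (sum-sq m≈0 , sum-sq (trans (+-comm _ _) m≈0))
        where
        sum-sq : ∀ {p q} → p * p + q * q ≈ 0# → p ≈ 0#
        sum-sq {p} {q} eq = ≈-stable λ p≉0 → p≉0 (integral (≤-antisym
          (≤-respʳ eq (≤-cert (0≤x*x q) (solve 2 (λ p q → (p :+ q) :- p := q) refl _ _))) (0≤x*x p)) p≉0)
      quadratic : w * w ≈ β * w + γ
      quadratic = ≈-cert (m ⊛ diff on-circle ⊕ (- (p * x + q * y + r + p * e + q * f)) ⊛ diff on-line)
        (solve 8 (λ p q r e f g x y →
           (q :* x :- p :* y) :* (q :* x :- p :* y)
             :- ((p :* f :- q :* e) :* (q :* x :- p :* y) :+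
                 ((p :* p :+ q :* q) :* g :- r :* r :- r :* (p :* e :+ q :* f)))
           := (p :* p :+ q :* q) :* ((x :* x :+ y :* y :+ (e :* x :+ f :* y)) :- g)
             :+ :- (p :* x :+ q :* y :+ r :+ p :* e :+ q :* f) :*
                 ((p :* x :+ q :* y) :- r)) refl p q r e f g x y)

    SameSolutions : Equation → Equation → Set (c ⊔ ℓ₁)
    SameSolutions K L = ∀ P → Satisfies P K → Satisfies P L

    -- Cramer's rule applies, since with determinant 0 the lines would be parallel and, sharing (x ,
    -- y), equal. The point already lies in F.
    line-line : ∀ {p q r p′ q′ r′ x y} → Proper (lin p q r) → Proper (lin p′ q′ r′) →
      ¬ (SameSolutions (lin p q r) (lin p′ q′ r′) × SameSolutions (lin p′ q′ r′) (lin p q r)) →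
      Satisfies (x , y) (lin p q r) → Satisfies (x , y) (lin p′ q′ r′) → ¬ ¬ ReachedBy (x , y)
    line-line {p} {q} {r} {p′} {q′} {r′} {x} {y} (p∈ , q∈ , r∈ , pq≉0)
        (p′∈ , q′∈ , r′∈ , pq′≉0) differ on on′ k =
      inverse det≉0 λ (z , dz≈1) →
      let z∈ = inv∈ (sub∈ (*∈ p∈ q′∈) (*∈ p′∈ q∈)) dz≈1 in
      k (F , (λ x∈ → x∈) ,
        resp (≈-cert (x ⊛ diff dz≈1 ⊕ (- (z * q′)) ⊛ diff on ⊕ (z * q) ⊛ diff on′)
               (solve 9 (λ x y z p q r p′ q′ r′ → z :* (r :* q′ :- r′ :* q) :- x :=
                  x :* ((p :* q′ :- p′ :* q) :* z :- :1) :+ :- (z :* q′) :*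
                      ((p :* x :+ q :* y) :- r) :+ (z :* q) :* ((p′ :* x :+ q′ :* y) :- r′))
                  refl x y z p q r p′ q′ r′))
          (*∈ z∈ (sub∈ (*∈ r∈ q′∈) (*∈ r′∈ q∈))) ,
        resp (≈-cert (y ⊛ diff dz≈1 ⊕ (- (z * p)) ⊛ diff on′ ⊕ (z * p′) ⊛ diff on)
               (solve 9 (λ x y z p q r p′ q′ r′ → z :* (p :* r′ :- p′ :* r) :- y :=
                  y :* ((p :* q′ :- p′ :* q) :* z :- :1) :+ :- (z :* p) :*
                      ((p′ :* x :+ q′ :* y) :- r′) :+ (z :* p′) :* ((p :* x :+ q :* y) :- r))
                  refl x y z p q r p′ q′ r′))
          (*∈ z∈ (sub∈ (*∈ p∈ r′∈) (*∈ p′∈ r∈))))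
      where
      same : ∀ {p q r p′ q′ r′} → ¬ (p ≈ 0# × q ≈ 0#) → p * q′ - p′ * q ≈ 0# →
        p * x + q * y ≈ r → p′ * x + q′ * y ≈ r′ → SameSolutions (lin p q r) (lin p′ q′ r′)
      -- Both p and q annihilate the deviation of (X , Y) from the second line, so a nonzero
      -- deviation would force p = q = 0.
      same {p} {q} {r} {p′} {q′} {r′} pq≉0 det≈0 on on′ (X , Y) onX = ≈-stable λ not-on → pq≉0
        (≈-stable (λ p≉0 → not-on (cancel
            (p′ ⊛ diff onX ⊕ (- p′) ⊛ diff on ⊕ (Y - y) ⊛ det≈0 ⊕ p ⊛ diff on′)
          (solve 10 (λ p q r p′ q′ r′ x y X Y → p :* ((p′ :* X :+ q′ :* Y) :- r′) :=
             p′ :* ((p :* X :+ q :* Y) :- r) :+ :- p′ :* ((p :* x :+ q :* y) :- r) :+ (Y :- y) :*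
                 (p :* q′ :- p′ :* q)
               :+ p :* ((p′ :* x :+ q′ :* y) :- r′)) refl p q r p′ q′ r′ x y X Y) p≉0)) ,
         ≈-stable (λ q≉0 → not-on (cancel
             (q′ ⊛ diff onX ⊕ (- q′) ⊛ diff on ⊕ (- (X - x)) ⊛ det≈0 ⊕ q ⊛ diff on′)
          (solve 10 (λ p q r p′ q′ r′ x y X Y → q :* ((p′ :* X :+ q′ :* Y) :- r′) :=
             q′ :* ((p :* X :+ q :* Y) :- r) :+ :- q′ :* ((p :* x :+ q :* y) :- r) :+ :- (X :- x) :*
                 (p :* q′ :- p′ :* q)
               :+ q :* ((p′ :* x :+ q′ :* y) :- r′)) refl p q r p′ q′ r′ x y X Y) q≉0)))
        where
        cancel : ∀ {u v v′ t} → t ≈ 0# → u * (v - v′) ≈ t → ¬ (u ≈ 0#) → v ≈ v′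
        cancel t≈0 eq u≉0 = ≈-cert (integral (trans eq t≈0) u≉0) refl
      det≉0 : ¬ (p * q′ - p′ * q ≈ 0#)
      det≉0 det≈0 = differ
        (same pq≉0 det≈0 on on′ ,
         same pq′≉0 (trans (solve 4 (λ p q p′ q′ → p′ :* q :- p :* q′
             := :- (p :* q′ :- p′ :* q)) refl p q p′ q′)
                           (trans (-‿cong det≈0) (solve 0 (:- :0 := :0) refl))) on′ on)

    -- The difference of the two equations is the radical axis, which reduces the case to a line and
    -- a circle. Were it degenerate, the circles would be concentric and, sharing a point, equal.
    circle-circle : ∀ {e f g e′ f′ g′ x y} → Proper (circ e f g) → Proper (circ e′ f′ g′) →
      ¬ (SameSolutions (circ e f g) (circ e′ f′ g′) × SameSolutions (circ e′ f′ g′) (circ e f g)) →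
      Satisfies (x , y) (circ e f g) → Satisfies (x , y) (circ e′ f′ g′) → ¬ ¬ ReachedBy (x , y)
    circle-circle {e} {f} {g} {e′} {f′} {g′} {x} {y} (e∈ , f∈ , g∈) (e′∈ , f′∈ , g′∈) differ on on′ =
      line-circle
        (sub∈ e∈ e′∈ , sub∈ f∈ f′∈ , sub∈ g∈ g′∈ , λ (e-e′≈0 , f-f′≈0) →
          differ (same (≈-cert e-e′≈0 refl) (≈-cert f-f′≈0 refl) on on′ ,
                  same (sym (≈-cert e-e′≈0 refl)) (sym (≈-cert f-f′≈0 refl)) on′ on))
        (e∈ , f∈ , g∈)
        (≈-cert (diff on ⊕ (- 1#) ⊛ diff on′)
          (solve 8 (λ e f g e′ f′ g′ x y → ((e :- e′) :* x :+ (f :- f′) :* y) :- (g :- g′) :=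
             ((x :* x :+ y :* y :+ (e :* x :+ f :* y)) :- g) :+ :- :1 :*
                 ((x :* x :+ y :* y :+ (e′ :* x :+ f′ :* y)) :- g′))
             refl e f g e′ f′ g′ x y))
        on
      where
      same : ∀ {e f g e′ f′ g′} → e ≈ e′ → f ≈ f′ →
        x * x + y * y + (e * x + f * y) ≈ g → x * x + y * y + (e′ * x + f′ * y) ≈ g′ →
        SameSolutions (circ e f g) (circ e′ f′ g′)
      same e≈e′ f≈f′ on on′ P onP =
        trans (+-congˡ (+-cong (*-congʳ (sym e≈e′)) (*-congʳ (sym f≈f′))))
          (trans onP (trans (sym on) (trans (+-congˡ (+-cong (*-congʳ e≈e′) (*-congʳ f≈f′))) on′)))

    intersection : ∀ K L {P} → Proper K → Proper L →
      ¬ (SameSolutions K L × SameSolutions L K) → Satisfies P K → Satisfies P L → ¬ ¬ ReachedBy P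
    intersection (lin _ _ _)  (lin _ _ _)  = line-line
    intersection (lin _ _ _)  (circ _ _ _) pK pL _ onK onL = line-circle pK pL onK onL
    intersection (circ _ _ _) (lin _ _ _)  pK pL _ onK onL = line-circle pL pK onL onK
    intersection (circ _ _ _) (circ _ _ _) = circle-circle

    proper-line : ∀ {A B} → PointIn A → PointIn B → ¬ (_≈ₚ_ ℝ A B) → Proper (equation (line A B))
    proper-line {a , b} {a′ , b′} (a∈ , b∈) (a′∈ , b′∈) A≉B =
      sub∈ b′∈ b∈ , -∈ (sub∈ a′∈ a∈) , sub∈ (*∈ a∈ (sub∈ b′∈ b∈)) (*∈ b∈ (sub∈ a′∈ a∈)) ,
      λ (b′-b≈0 , a-a′≈0) → A≉B
        (≈-cert a-a′≈0 (solve 2 (λ a a′ → a :- a′ := :- (a′ :- a)) refl a a′) ,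
         sym (≈-cert b′-b≈0 refl))

    proper-circle : ∀ {A B} → PointIn A → PointIn B → Proper (equation (circle A B))
    proper-circle {o , o′} {u , v} (o∈ , o′∈) (u∈ , v∈) =
      -∈ (+∈ o∈ o∈) , -∈ (+∈ o′∈ o′∈) ,
      sub∈ (+∈ (*∈ (sub∈ u∈ o∈) (sub∈ u∈ o∈)) (*∈ (sub∈ v∈ o′∈) (sub∈ v∈ o′∈))) (+∈ (*∈ o∈ o∈) (*∈ o′∈ o′∈))

  open Step using (PointIn; Proper; ReachedBy)

  Proper-mono : ∀ {a} {F G : RootFree a} → F ⊆ G → ∀ K → Proper F K → Proper G K
  Proper-mono F⊆G (lin p q r)  (p∈ , q∈ , r∈ , pq≉0) = F⊆G p∈ , F⊆G q∈ , F⊆G r∈ , pq≉0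
  Proper-mono F⊆G (circ e f g) (e∈ , f∈ , g∈)        = F⊆G e∈ , F⊆G f∈ , F⊆G g∈

  module _ {a : Carrier} {ℓ : Level} {S : Pred (Point ℝ) ℓ} where

    mutual
      -- F is arbitrary in the induction because each further point or curve is reached from the
      -- field in which the previous ones already lie.
      constructible : (F : RootFree a) → (∀ {P} → S P → PointIn F P) →
        ∀ {P} → Constructible ℝ S P → ¬ ¬ ReachedBy F P
      constructible F S∈ (given P∈S) k = let (x∈ , y∈) = S∈ P∈S in k (F , (λ x∈ → x∈) , x∈ , y∈)
      constructible F S∈ (intersect {P} {K} {L} dK dL K≢L onK onL) k =
        drawable F S∈ dK λ (G , F⊆G , pK) →
        drawable G (λ P∈ → let (x∈ , y∈) = S∈ P∈ in F⊆G x∈ , F⊆G y∈) dL λ (H , G⊆H , pL) →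
        Step.intersection H (equation K) (equation L) (Proper-mono G⊆H (equation K) pK) pL
          (λ (K⊆L , L⊆K) → K≢L λ Q → mk⇔
            (λ on → from (on⇔satisfies Q L) (K⊆L Q (to (on⇔satisfies Q K) on)))
            (λ on → from (on⇔satisfies Q K) (L⊆K Q (to (on⇔satisfies Q L) on))))
          (to (on⇔satisfies P K) onK) (to (on⇔satisfies P L) onL)
          λ (I , H⊆I , x∈ , y∈) → k (I , (λ x∈ → H⊆I (G⊆H (F⊆G x∈))) , x∈ , y∈)
        where open Equivalence using (to; from)

      drawable : (F : RootFree a) → (∀ {P} → S P → PointIn F P) →
        ∀ {K} → Drawable ℝ S K → ¬ ¬ (∃[ G ] F ⊆ G × Proper G (equation K))
      drawable F S∈ (draw-line cA cB A≉B) k = both F S∈ cA cB λ (G , F⊆G , A∈ , B∈) →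
        k (G , F⊆G , Step.proper-line G A∈ B∈ A≉B)
      drawable F S∈ (draw-circle cA cB A≉B) k = both F S∈ cA cB λ (G , F⊆G , A∈ , B∈) →
        k (G , F⊆G , Step.proper-circle G A∈ B∈)

      both : (F : RootFree a) → (∀ {P} → S P → PointIn F P) →
        ∀ {A B} → Constructible ℝ S A → Constructible ℝ S B → ¬ ¬ (∃[ G ] F ⊆ G × PointIn G A × PointIn G B)
      both F S∈ cA cB k =
        constructible F S∈ cA λ (G , F⊆G , x∈ , y∈) →
        constructible G (λ P∈ → let (x∈ , y∈) = S∈ P∈ in F⊆G x∈ , F⊆G y∈) cB λ (H , G⊆H , A∈ , B∈) →
        k (H , (λ x∈ → G⊆H (F⊆G x∈)) , (G⊆H x∈ , G⊆H y∈) , (A∈ , B∈))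

  -- The rational numbers in ℝ

  ι-injective : ∀ i j → ι i ≈ ι j → i ≡.≡ j
  ι-injective i j eq = ℤ.i-j≡0⇒i≡j i j (kernel (i ℤ.- j) (begin
    ι (i ℤ.- j)         ≈⟨ ι-+ i (ℤ.- j) ⟩
    ι i + ι (ℤ.- j)     ≈⟨ +-cong eq (ι-neg j) ⟩
    ι j - ι j           ≈⟨ -‿inverseʳ (ι j) ⟩
    0#                  ∎))
    where
    kernel : ∀ i → ι i ≈ 0# → i ≡.≡ ℤ.0ℤ
    kernel (+ zero)  _   = ≡.refl
    kernel (+ suc n) eq  = ⊥-elim (1+n≉0 n eq)
    kernel -[1+ n ]  eq  = ⊥-elim (1+n≉0 n
        (trans (solve 1 (λ x → x := :- :- x) refl _) (trans (-‿cong eq) (solve 0 (:- :0 := :0) refl))))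

  module _ (r s : ℤ) .{{_ : ℤ.NonZero s}} (3∤r : ¬ (3ℤ ℤ.∣ r)) (3∤s : ¬ (3ℤ ℤ.∣ s)) where

    A : ℚ
    A = (+ 3 ℤ.* r) ÷ℤ s

    a : Carrier
    a = ℚ⇒ℝ ℝ A

    -- With d the reduced denominator of A, cross-multiplication gives d (a s - 3 r) = 0, and d is
    -- not 0.
    a-fraction : a * ι s ≈ ι (3ℤ ℤ.* r)
    a-fraction = ≈-cert (integral (trans
        (solve 5 (λ d a s t u → d :* (a :* s :- t)
            := s :* (a :* d :- u) :+ (u :* s :- t :* d)) refl _ a (ι s) (ι (3ℤ ℤ.* r)) (ι (ℚ.↥ A)))
        (ι s ⊛ diff (ℚ⇒ℝ-* A) ⊕ diff (begin
          ι (ℚ.↥ A) * ι s            ≈⟨ ι-* (ℚ.↥ A) s ⟨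
          ι (ℚ.↥ A ℤ.* s)               ≡⟨ ≡.cong ι (↥÷ℤ (3ℤ ℤ.* r) s) ⟩
          ι ((3ℤ ℤ.* r) ℤ.* ℚ.↧ A)        ≈⟨ ι-* (3ℤ ℤ.* r) (ℚ.↧ A) ⟩
          ι (3ℤ ℤ.* r) * ι (ℚ.↧ A)     ∎)))
      (1+n≉0 (ℚ.denominator-1 A))) refl

    ι-cube : ∀ k i → ι (k ℤ.* (i ℤ.* i ℤ.* i)) ≈ ι k * (ι i * ι i * ι i)
    ι-cube k i = trans (ι-* k _) (*-congˡ (trans (ι-* (i ℤ.* i) i) (*-congʳ (ι-* i i))))

    -- Clearing denominators inside ℝ leaves an equation between images of integers; `ι` is
    -- injective, so the integer descent applies.
    no-fraction-root : ∀ {x} i n → x * ι (+ suc n) ≈ ι i → ¬ Root a x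
    no-fraction-root {x} i n xn≈i root = absurd (rootEquation⇒n≡0 r s 3∤r 3∤s {i} {+ suc n}
      (ι-injective _ _ (begin
        ι (s ℤ.* (i ℤ.* i ℤ.* i))
          ≈⟨ ι-cube s i ⟩
        S * (I * I * I)
          ≈⟨ *-congˡ (*-cong (*-cong xn≈i xn≈i) xn≈i) ⟨
        S * ((x * N) * (x * N) * (x * N))
          ≈⟨ solve 3 (λ s x n → s :* ((x :* n) :* (x :* n) :* (x :* n))
              := s :* (n :* n :* n) :* (x :* x :* x)) refl S x N ⟩
        S * (N * N * N) * (x * x * x)
          ≈⟨ *-congˡ root ⟩
        S * (N * N * N) * ((x + (x + x)) + a)
          ≈⟨ solve 4 (λ s x n a → s :* (n :* n :* n) :* ((x :+ (x :+ x)) :+ a) :=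
               (s :* (x :* n) :* (n :* n) :+ (s :* (x :* n) :* (n :* n) :+ s :* (x :* n) :*
                   (n :* n))) :+ (a :* s) :* (n :* n :* n)) refl S x N a ⟩
        (S * (x * N) * (N * N) + (S * (x * N) * (N * N) + S * (x * N) * (N * N))) + (a * S) * (N * N * N)
          ≈⟨ +-cong (+-cong t≈ (+-cong t≈ t≈)) (*-congʳ a-fraction) ⟩
        (ι t + (ι t + ι t)) + ι (3ℤ ℤ.* r) * (N * N * N)
          ≈⟨ +-cong (+-congˡ (ι-+ t t)) (ι-cube (3ℤ ℤ.* r) (+ suc n)) ⟨
        (ι t + ι (t ℤ.+ t)) + ι ((3ℤ ℤ.* r) ℤ.* (+ suc n ℤ.* + suc n ℤ.* + suc n))
          ≈⟨ +-congʳ (ι-+ t (t ℤ.+ t)) ⟨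
        ι (t ℤ.+ (t ℤ.+ t)) + ι ((3ℤ ℤ.* r) ℤ.* (+ suc n ℤ.* + suc n ℤ.* + suc n))
          ≈⟨ ι-+ (t ℤ.+ (t ℤ.+ t)) _ ⟨
        ι (t ℤ.+ (t ℤ.+ t) ℤ.+ (3ℤ ℤ.* r) ℤ.* (+ suc n ℤ.* + suc n ℤ.* + suc n)) ∎)))
      where
      absurd : ¬ (+ suc n ≡.≡ ℤ.0ℤ)
      absurd ()
      S I N : Carrier
      S = ι s
      I = ι i
      N = ι (+ suc n)
      t : ℤ
      t = s ℤ.* i ℤ.* (+ suc n ℤ.* + suc n)
      t≈ : S * (x * N) * (N * N) ≈ ι t
      t≈ = trans (*-cong (trans (*-congˡ xn≈i) (sym (ι-* s i))) (sym (ι-* (+ suc n) (+ suc n))))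
          (sym (ι-* (s ℤ.* i) _))

    -- Any representing fraction is allowed, reduced or not, so the field operations involve no
    -- normalisation.
    Fraction : Carrier → Set ℓ₁
    Fraction x = ∃[ i ] ∃[ n ] x * ι (+ suc n) ≈ ι i

    rationals : RootFree a
    rationals = record
      { _∈F    = λ x → Lift c (¬ ¬ Fraction x)
      ; stable = λ ¬¬x → lift λ k → ¬¬x λ x → lower x k
      ; resp   = λ x≈y x∈ → lift λ k → lower x∈ λ (i , n , eq) → k (i , n , trans (*-congʳ (sym x≈y)) eq)
      ; a∈     = lift λ k → k (ℚ.↥ A , ℚ.denominator-1 A , ℚ⇒ℝ-* A)
      ; 1∈     = lift λ k → k (+ 1 , 0 , *-identityˡ _)
      ; +∈     = λ x∈ y∈ → lift λ k → lower x∈ λ (i , m , p) → lower y∈ λ (j , n , q) →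
          -- The successor of `n + m * suc n` is the product of the denominators `suc m` and `suc n`
          -- by computation.
          k (i ℤ.* + suc n ℤ.+ j ℤ.* + suc m , n ℕ.+ m ℕ.* suc n , plus i m j n p q)
      ; *∈     = λ x∈ y∈ → lift λ k → lower x∈ λ (i , m , p) → lower y∈ λ (j , n , q) →
          k (i ℤ.* j , n ℕ.+ m ℕ.* suc n , times i m j n p q)
      ; -∈     = λ x∈ → lift λ k → lower x∈ λ (i , m , p) →
          k (ℤ.- i , m , trans (solve 2 (λ x m → :- x :* m := :- (x :* m)) refl _ _)
              (trans (-‿cong p) (sym (ι-neg i))))
      ; inv∈   = λ x∈ xy≈1 → lift λ k → lower x∈ λ (i , m , p) → invert i m p xy≈1 k
      ; noRoot = λ x∈ root → lower x∈ λ (i , n , p) → no-fraction-root i n p root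
      }
      where
      plus : ∀ {x y} i m j n → x * ι (+ suc m) ≈ ι i → y * ι (+ suc n) ≈ ι j →
        (x + y) * ι (+ (suc m ℕ.* suc n)) ≈ ι (i ℤ.* + suc n ℤ.+ j ℤ.* + suc m)
      plus {x} {y} i m j n p q = begin
        (x + y) * ι (+ (suc m ℕ.* suc n))
          ≈⟨ *-congˡ (·-homo-* (suc m) (suc n)) ⟩
        (x + y) * (M * N)
          ≈⟨ solve 4 (λ x y m n → (x :+ y) :* (m :* n) := (x :* m) :* n :+ (y :* n) :* m) refl x y M N ⟩
        (x * M) * N + (y * N) * M
          ≈⟨ +-cong (*-congʳ p) (*-congʳ q) ⟩
        ι i * N + ι j * M
          ≈⟨ +-cong (ι-* i (+ suc n)) (ι-* j (+ suc m)) ⟨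
        ι (i ℤ.* + suc n) + ι (j ℤ.* + suc m)
          ≈⟨ ι-+ (i ℤ.* + suc n) _ ⟨
        ι (i ℤ.* + suc n ℤ.+ j ℤ.* + suc m) ∎
        where
        M N : Carrier
        M = ι (+ suc m)
        N = ι (+ suc n)
      times : ∀ {x y} i m j n → x * ι (+ suc m) ≈ ι i → y * ι (+ suc n) ≈ ι j →
        (x * y) * ι (+ (suc m ℕ.* suc n)) ≈ ι (i ℤ.* j)
      times {x} {y} i m j n p q = begin
        (x * y) * ι (+ (suc m ℕ.* suc n))
          ≈⟨ *-congˡ (·-homo-* (suc m) (suc n)) ⟩
        (x * y) * (ι (+ suc m) * ι (+ suc n))
          ≈⟨ solve 4 (λ x y m n → (x :* y) :* (m :* n) := (x :* m) :* (y :* n)) refl x y _ _ ⟩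
        (x * ι (+ suc m)) * (y * ι (+ suc n))
          ≈⟨ *-cong p q ⟩
        ι i * ι j
          ≈⟨ ι-* i j ⟨
        ι (i ℤ.* j) ∎
      inverse-fraction : ∀ {x y} i m → x * ι (+ suc m) ≈ ι i → x * y ≈ 1# → y * ι i ≈ ι (+ suc m)
      inverse-fraction {x} {y} i m p xy≈1 = begin
        y * ι i                  ≈⟨ *-congˡ p ⟨
        y * (x * ι (+ suc m))   ≈⟨ solve 3 (λ x y m → y :* (x :* m) := x :* y :* m) refl x y _ ⟩
        x * y * ι (+ suc m)     ≈⟨ *-congʳ xy≈1 ⟩
        1# * ι (+ suc m)         ≈⟨ *-identityˡ _ ⟩
        ι (+ suc m)               ∎
      invert : ∀ {x y} i m → x * ι (+ suc m) ≈ ι i → x * y ≈ 1# → ¬ ¬ Fraction y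
      invert {x} {y} (+ zero) m p xy≈1 k = 1+n≉0 m (trans (sym (inverse-fraction (+ 0) m p xy≈1)) (zeroʳ y))
      invert (+ suc i) m p xy≈1 k = k (+ suc m , i , inverse-fraction (+ suc i) m p xy≈1)
      invert -[1+ i ] m p xy≈1 k = k (-[1+ m ] , i ,
        trans (solve 2 (λ y i → y :* i := :- (y :* :- i)) refl _ _)
            (-‿cong (inverse-fraction -[1+ i ] m p xy≈1)))

    ¬Tri : ¬ Tri ℝ a
    ¬Tri (α , (x , _) , ((p , q) , (u , v) , isP , isQ , constr) , isX , a≈2x) =
      inverse (2≉0 {a}) λ (h , 2h≈1) →
      let p∈ = resp (≈-cert (p ⊛ diff 2h≈1 ⊕ h ⊛ diff a≈2p)
                 (solve 3 (λ a p h → h :* a :- p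
                     := p :* ((:1 :+ :1) :* h :- :1) :+ h :* (a :- (p :+ p))) refl a p h))
               (*∈ (inv∈ (+∈ 1∈ 1∈) 2h≈1) a∈)
      in
      adjoin rationals {q}
        (resp (≈-cert (diff (sym (cos²+sin²≈1 csP)))
                (solve 2 (λ p q → (:1 :- p :* p) :- q :* q := :1 :- (p :* p :+ q :* q)) refl p q))
          (sub∈ 1∈ (*∈ p∈ p∈)))
      λ (G , ℚ⊆G , q∈G) → constructible G (λ where
          (inj₁ (x≈0 , y≈0))        → RootFree.resp G (sym x≈0) (RootFree.0∈ G) , RootFree.resp G
              (sym y≈0) (RootFree.0∈ G)
          (inj₂ (inj₁ (x≈1 , y≈0))) → RootFree.resp G (sym x≈1) (RootFree.1∈ G) , RootFree.resp G
              (sym y≈0) (RootFree.0∈ G)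
          (inj₂ (inj₂ (x≈p , y≈q))) → RootFree.resp G (sym x≈p) (ℚ⊆G p∈) , RootFree.resp G (sym y≈q) q∈G)
        constr
      -- As p = 4 u³ - 3 u, the element 2 u of H satisfies (2 u)³ - 3 (2 u) = 2 p = a.
      λ (H , _ , u∈ , _) → RootFree.noRoot H (RootFree.+∈ H u∈ u∈)
        (≈-cert ((1# + 1#) ⊛ diff (sym (cos-triple csQ (CosSin-cong (sym 3θ≈α) csP))) ⊕ diff (sym a≈2p))
          (solve 3 (λ a p u → (u :+ u) :* (u :+ u) :* (u :+ u) :-
              (((u :+ u) :+ ((u :+ u) :+ (u :+ u))) :+ a) :=
             (:1 :+ :1) :* ((u :* u :* u :+ (u :* u :* u :+ (u :* u :* u :+ u :* u :* u)) :-
                 (u :+ (u :+ u))) :- p)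
               :+ ((p :+ p) :- a)) refl a p u))
      where
      open RootFree rationals using (resp; sub∈; +∈; *∈; 1∈; inv∈; a∈)
      csP : CosSin α p q
      csP = isCosSin⇒CosSin isP
      csQ : CosSin (ℚ⇒ℝ ℝ (+ 1 ℚ./ 3) * α) u v
      csQ = isCosSin⇒CosSin isQ
      -- `Tri` and `Trisectable` supply their points for α independently; uniqueness of limits
      -- identifies the two cosines.
      a≈2p : a ≈ p + p
      a≈2p = trans a≈2x (trans (+-congˡ (+-identityʳ x)) (+-cong x≈p x≈p))
        where
        x≈p : x ≈ p
        x≈p = proj₁ (CosSin-unique (isCosSin⇒CosSin isX) csP)
      3θ≈α : (ℚ⇒ℝ ℝ (+ 1 ℚ./ 3) * α) + (ℚ⇒ℝ ℝ (+ 1 ℚ./ 3) * α) + (ℚ⇒ℝ ℝ (+ 1 ℚ./ 3) * α) ≈ α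
      3θ≈α = ≈-cert (α ⊛ diff (trans (ℚ⇒ℝ-/ (+ 1) 3) (+-identityʳ 1#)))
        (solve 2 (λ t α → (t :* α :+ t :* α :+ t :* α) :- α
            := α :* (t :* (:1 :+ (:1 :+ (:1 :+ :0))) :- :1)) refl (ℚ⇒ℝ ℝ (+ 1 ℚ./ 3)) α)

open import Data.Integer.Base using (_*_; NonZero)
open import Data.Rational.Base using (_≤_; _/_)

proposition3p3 : ∀ {c ℓ₁ ℓ₂ : Level} (r s : ℤ) .{{_ : NonZero r}} .{{_ : NonZero s}} →
    Coprime r s → Coprime r (+ 3) → Coprime s (+ 3) →
    Irreducible p[x, (+ 3 * r) ÷ℤ s ] ×
    ((ℝ : RealNumbers c ℓ₁ ℓ₂) →
    -[1+ 1 ] / 1 ≤ (+ 3 * r) ÷ℤ s → (+ 3 * r) ÷ℤ s ≤ + 2 / 1 →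
    ¬ Tri ℝ (ℚ⇒ℝ ℝ ((+ 3 * r) ÷ℤ s)))
proposition3p3 r s _ r⊥3 s⊥3 =
  irreducible (no-rational-root r s 3∤r 3∤s) , λ ℝ _ _ → Reals.¬Tri ℝ r s 3∤r 3∤s
  where
  3∤r : ¬ (3ℤ ℤ.∣ r)
  3∤r = coprime-3 r r⊥3
  3∤s : ¬ (3ℤ ℤ.∣ s)
  3∤s = coprime-3 s s⊥3
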